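{- Let $E = (E^0, E^1, r, s)$ be a finite directed graph, and let $A_E$ be its adjacency matrix. Then the Parry-Sullivan number $\mathcal{PS}(E) = \det(I - A_E)$ is equal to the number of vertex-disjoint sets of circuits of $E$ having even cardinality minus the number of vertex-disjoint sets of circuits of $E$ having odd cardinality. (The empty set of circuits is vertex-disjoint and of even cardinality.)
   Context: A (directed) graph $E$ is a 4-tuple $(E^0, E^1, r, s)$, where $E^0$ is a set of vertices, $E^1$ is a set of edges, and $r, s : E^1 \to E^0$ assign to each edge its range and source, respectively; loops and multiple edges are allowed. It is finite if $E^0$ and $E^1$ are finite. If $E$ has $n$ vertices, enumerated $1, \dots, n$, its adjacency matrix $A_E$ is the $n \times n$ integer matrix whose entry $(A_E)_{ij}$ is the number of edges from the $i$th vertex to the $j$th vertex. The Parry-Sullivan number is $\mathcal{PS}(E) = \det(I - A_E)$, with $I$ the $n \times n$ identity matrix. A (directed) cycle of $E$ is a sequence of edges $e_1 e_2 \cdots e_m$ with $m \geq 1$ such that $r(e_i) = s(e_{i+1})$ for $1 \leq i < m$, $r(e_m) = s(e_1)$, and $s(e_i) \neq s(e_j)$ whenever $i \neq j$. A (directed) circuit of $E$ is a finite set of edges $C \subseteq E^1$ whose elements can be arranged (each used exactly once) into a directed cycle; thus circuits are not distinguished by a starting vertex, but circuits using different parallel edges are different. A set $\mathcal{C}$ of circuits is vertex-disjoint if for any two distinct $C_1, C_2 \in \mathcal{C}$ the sets $\{ s(e) \mid e \in C_1 \}$ and $\{ s(e) \mid e \in C_2 \}$ are disjoint. The size (cardinality)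 of a set of circuits is the number of circuits in it. -}

module Defs where

open import Level using (Level; suc; _⊔_)
open import Data.Nat.Base as ℕ using (ℕ; zero)
open import Data.Nat.Divisibility using (_∣?_)
open import Data.Integer.Base as ℤ using (ℤ; +_; 1ℤ; 0ℤ; -1ℤ)
import Data.Integer.Properties as ℤ
open import Data.Fin.Base using (Fin; toℕ; fromℕ; fromℕ<; inject₁; punchIn)
import Data.Fin.Base as Fin
open import Data.Fin.Properties
  using (_≟_; any?; all?; inj⇒≟; injective⇒≤; toℕ-fromℕ<)
open import Data.Fin.Subset using (Subset; inside; outside; _∈_; ∣_∣)
open import Data.Fin.Subset.Properties using (_∈?_)
open import Data.Vec.Base as Vec using (Vec; []; _∷_; lookup)
import Data.Vec.Properties as Vec
open import Data.List.Base as List using (List; length; filter; allFin)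
open import Data.Bool.Base using (if_then_else_)
open import Data.Product.Base using (∃; Σ; _×_; _,_)
open import Data.Product using (∃!)
open import Function.Base using (_∘_)
open import Function.Bundles using (_↔_; Inverse; Injection)
open import Function.Properties.Inverse using (↔⇒↣)
open import Relation.Binary.Definitions using (DecidableEquality)
open import Relation.Binary.PropositionalEquality
  using (_≡_; _≢_; refl; sym; trans; subst)
open import Relation.Nullary
  using (Dec; does; ¬?; _×-dec_; _→-dec_)
open import Relation.Nullary.Decidable using (map′; decidable-stable)
open import Relation.Unary using (Pred; Decidable; _⊥_)
open import Algebra.Properties.Semiring.Sum ℤ.+-*-semiring using (sum)

private
  variable
    a b p : Level
    k n : ℕ

Matrix : ℕ → Set
Matrix n = Fin n → Fin n → ℤ

identity : Matrix n
identity i j = if does (i ≟ j) then 1ℤ else 0ℤ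

infixl 6 _⊝_

_⊝_ : Matrix n → Matrix n → Matrix n
(M ⊝ N) i j = M i j ℤ.- N i j

-- Laplace expansion along the first row.
det : Matrix n → ℤ
det {zero}    M = 1ℤ
det {ℕ.suc n} M = sum λ j →
  (-1ℤ ℤ.^ toℕ j) ℤ.* (M Fin.zero j ℤ.* det λ i l → M (Fin.suc i) (punchIn j l))

-- Every subset occurs exactly once.
subsets : ∀ n → List (Subset n)
subsets zero      = [] List.∷ List.[]
subsets (ℕ.suc n) =
  List.map (inside ∷_) (subsets n) List.++ List.map (outside ∷_) (subsets n)

private
  anyVec? : {P : Pred (Vec (Fin n) k) p} → Decidable P → Dec (∃ P)
  anyVec? {k = zero}    P? = map′ ([] ,_) (λ { ([] , px) → px }) (P? [])
  anyVec? {k = ℕ.suc k} P? =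
    map′ (λ { (x , xs , px) → x ∷ xs , px })
         (λ { (x ∷ xs , px) → x , xs , px })
         (any? λ x → anyVec? λ xs → P? (x ∷ xs))

  ∃!? : {P : Pred (Fin n) p} → Decidable P → Dec (∃! _≡_ P)
  ∃!? P? = any? λ i → P? i ×-dec
    map′ (λ f {j} → f j) (λ f j → f {j}) (all? λ j → P? j →-dec (i ≟ j))

record Graph a b : Set (suc (a ⊔ b)) where
  field
    Vertex : Set a
    Edge   : Set b
    range  : Edge → Vertex
    source : Edge → Vertex

record Finite (E : Graph a b) : Set (a ⊔ b) where
  open Graph E
  field
    #vertices : ℕ
    #edges    : ℕ
    vertices  : Vertex ↔ Fin #vertices
    edges     : Edge ↔ Fin #edges

  vertexIndex : Vertex → Fin #vertices
  vertexIndex = Inverse.to vertices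

  edge : Fin #edges → Edge
  edge = Inverse.from edges

  edgeIndex : Edge → Fin #edges
  edgeIndex = Inverse.to edges

module _ (E : Graph a b) where
  open Graph E

  -- The sequence e has length suc k, so it is non-empty.
  record IsCycle (e : Vec Edge (ℕ.suc k)) : Set a where
    field
      consecutive : ∀ (i : Fin k) →
        range (lookup e (inject₁ i)) ≡ source (lookup e (Fin.suc i))
      closed      : range (lookup e (fromℕ k)) ≡ source (lookup e Fin.zero)
      distinct    : ∀ i j → i ≢ j → source (lookup e i) ≢ source (lookup e j)

-- Sets of edges are given as sets of edge indices.
module _ (E : Graph a b) (fin : Finite E) where
  open Graph E
  open Finite fin

  adjacency : Matrix #vertices
  adjacency i j = + length (filter
    (λ x → (vertexIndex (source (edge x)) ≟ i)
             ×-dec (vertexIndex (range (edge x)) ≟ j))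
    (allFin #edges))

  parrySullivan : ℤ
  parrySullivan = det (identity ⊝ adjacency)

  record Arranges (C : Subset #edges) (e : Vec Edge k) : Set b where
    field
      used     : ∀ i → edgeIndex (lookup e i) ∈ C
      usedOnce : ∀ x → x ∈ C → ∃! _≡_ λ i → lookup e i ≡ edge x

  IsCircuit : Pred (Subset #edges) (a ⊔ b)
  IsCircuit C = ∃ λ k → Σ (Vec Edge (ℕ.suc k)) λ e → IsCycle E e × Arranges C e

  private
    _≟ᵛ_ : DecidableEquality Vertex
    _≟ᵛ_ = inj⇒≟ (↔⇒↣ vertices)

    _≟ᵉ_ : DecidableEquality Edge
    _≟ᵉ_ = inj⇒≟ (↔⇒↣ edges)

    isCycle? : (e : Vec Edge (ℕ.suc k)) → Dec (IsCycle E e)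
    isCycle? e = map′
      (λ { (x , y , z) → record { consecutive = x ; closed = y ; distinct = z } })
      (λ c → let open IsCycle c in consecutive , closed , distinct)
      (all? (λ i → _ ≟ᵛ _) ×-dec (_ ≟ᵛ _) ×-dec
       all? (λ i → all? λ j → ¬? (i ≟ j) →-dec ¬? (_ ≟ᵛ _)))

    arranges? : (C : Subset #edges) (e : Vec Edge k) → Dec (Arranges C e)
    arranges? C e = map′
      (λ { (x , y) → record { used = x ; usedOnce = y } })
      (λ r → let open Arranges r in used , usedOnce)
      (all? (λ i → _ ∈? C) ×-dec
       all? (λ x → (x ∈? C) →-dec ∃!? λ i → _ ≟ᵉ _))

    anyEdges? : {P : Pred (Vec Edge k) p} → Decidable P → Dec (∃ P)
    anyEdges? {P = P} P? = map′
      (λ { (xs , px) → Vec.map edge xs , px })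
      (λ { (es , pes) → Vec.map edgeIndex es , subst P (sym (edge∘index es)) pes })
      (anyVec? (P? ∘ Vec.map edge))
      where
      edge∘index : ∀ {k} (es : Vec Edge k) → Vec.map edge (Vec.map edgeIndex es) ≡ es
      edge∘index es =
        trans (sym (Vec.map-∘ edge edgeIndex es))
          (trans (Vec.map-cong (Inverse.strictlyInverseʳ edges) es) (Vec.map-id es))

    cycle-length≤ : {e : Vec Edge (ℕ.suc k)} → IsCycle E e → ℕ.suc k ℕ.≤ #vertices
    cycle-length≤ {e = e} c = injective⇒≤ {f = vertexIndex ∘ source ∘ lookup e} λ {i} {j} eq →
      decidable-stable (i ≟ j) λ i≢j →
        IsCycle.distinct c i j i≢j (Injection.injective (↔⇒↣ vertices) eq)

  isCircuit? : Decidable IsCircuit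
  isCircuit? C = map′
    (λ { (k , w) → toℕ k , w })
    (λ { (k , e , c , r) → fromℕ< (cycle-length≤ c) ,
         subst (λ l → ∃ λ (e : Vec Edge (ℕ.suc l)) → IsCycle E e × Arranges C e)
               (sym (toℕ-fromℕ< (cycle-length≤ c))) (e , c , r) })
    (any? λ (k : Fin #vertices) → anyEdges? λ e → isCycle? e ×-dec arranges? C e)

  circuits : List (Subset #edges)
  circuits = filter isCircuit? (subsets #edges)

  -- The list of circuits has no repetitions, so a set of circuits is a set of
  -- positions in that list.
  CircuitSet : Set
  CircuitSet = Subset (length circuits)

  circuit : Fin (length circuits) → Subset #edges
  circuit = List.lookup circuits

  sources : Subset #edges → Pred Vertex a
  sources C v = ∃ λ x → x ∈ C × source (edge x) ≡ v

  VertexDisjoint : Pred CircuitSet a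
  VertexDisjoint 𝒞 = ∀ i j → i ∈ 𝒞 → j ∈ 𝒞 → i ≢ j →
    sources (circuit i) ⊥ sources (circuit j)

  private
    sources-⊥? : ∀ C D → Dec (sources C ⊥ sources D)
    sources-⊥? C D = map′
      (λ f → λ { ((x , x∈C , refl) , (y , y∈D , eq)) → f x y x∈C y∈D eq })
      (λ C⊥D x y x∈C y∈D eq → C⊥D ((x , x∈C , refl) , (y , y∈D , eq)))
      (all? λ x → all? λ y → (x ∈? C) →-dec ((y ∈? D) →-dec
        ¬? (source (edge y) ≟ᵛ source (edge x))))

  vertexDisjoint? : Decidable VertexDisjoint
  vertexDisjoint? 𝒞 = all? λ i → all? λ j →
    (i ∈? 𝒞) →-dec ((j ∈? 𝒞) →-dec (¬? (i ≟ j) →-dec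
      sources-⊥? (circuit i) (circuit j)))

  #evenVertexDisjoint : ℕ
  #evenVertexDisjoint = length
    (filter (λ 𝒞 → vertexDisjoint? 𝒞 ×-dec (2 ∣? ∣ 𝒞 ∣)) (subsets (length circuits)))

  #oddVertexDisjoint : ℕ
  #oddVertexDisjoint = length
    (filter (λ 𝒞 → vertexDisjoint? 𝒞 ×-dec ¬? (2 ∣? ∣ 𝒞 ∣)) (subsets (length circuits)))

module Submission where

-- Let A be the adjacency matrix. For a set S of vertices let detOn S be the
-- principal minor of I - A on S, and let packingSum S be the sum of the signs
-- -1 ^ ∣ 𝒞 ∣ over the vertex-disjoint sets 𝒞 of circuits with all vertices in S.
-- The theorem is the equality detOn S = packingSum S for the set S of all
-- vertices. Both sides equal 1 for empty S, and for each vertex v in S both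
-- satisfy the recursion
--
--   F S = F (S without v) - sum of F (S without the vertices of C),
--
-- where C runs over the circuits through v with all vertices in S; induction on
-- the size of S gives the result (detOn≡packingSum).
--
-- For packingSum the recursion holds because a vertex-disjoint set contains at
-- most one circuit through v (packingSum-through). For detOn, row v of I - A is the
-- unit vector of v minus the unit vectors of the ranges of the edges leaving v.
-- Expanding along it gives detOn (S without v) and, for each edge from v to some
-- w, minus the determinant with row v replaced by the unit vector of w. Expanding
-- this along row w, then along the row of the range of the chosen edge, and so
-- on, follows a path step by step: the sign of each edge is cancelled by a row
-- exchange (detTo-expand), a path that meets an earlier vertex other than v or
-- leaves S contributes 0 because of a repeated row (detTo-∉), and a path that
-- returns to v has become a cycle C and contributes the principal minor on the
-- complement of C in S (detTo-diagonal). This is detOn-recursion. The only facts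
-- about determinants that enter are additivity in each row, the vanishing for
-- equal rows and, for empty S, the value 1 at the identity matrix.
--
-- A circuit through v has exactly one arrangement that starts at v, so the closed
-- paths at v correspond bijectively to the circuits through v (circuits-through).

open import Defs
open import Data.Integer.Base using (+_; _-_)
open import Relation.Binary.PropositionalEquality using (_≡_)

open import Data.Bool.Base using (Bool; true; false; if_then_else_)
open import Data.Empty using (⊥-elim)
open import Data.Fin.Base using (Fin; zero; suc; toℕ; fromℕ; inject₁; punchIn; pinch)
open import Data.Fin.Properties using (_≟_; suc-injective)
open import Data.Fin.Subset
  using (Subset; inside; outside; _∈_; _∉_; _⊆_; _∪_; _─_; ⁅_⁆; ∣_∣; ⊥; ⊤; Empty; Nonempty)
  renaming (_-_ to _∖_)
open import Data.Fin.Subset.Properties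
open import Data.Integer.Base using (ℤ; -_; _+_; _*_; _^_; 0ℤ; 1ℤ; -1ℤ)
import Data.Integer.Properties as ℤ
open import Data.Integer.Tactic.RingSolver using (solve-∀)
open import Data.List.Base
  using (List; []; _∷_; _++_; map; foldr; filter; concatMap; allFin; length; lookup; tabulate)
open import Data.List.Properties using (map-∘; map-tabulate; ∷-injectiveʳ)
open import Data.List.Membership.Propositional
  using (find; lose) renaming (_∈_ to _∈ˡ_; _∉_ to _∉ˡ_)
open import Data.List.Membership.Propositional.Properties
open import Data.List.Membership.Propositional.Properties.WithK using (unique∧set⇒bag)
open import Data.List.Relation.Binary.BagAndSetEquality using (∼bag⇒↭)
open import Data.List.Relation.Binary.Disjoint.Propositional
  using () renaming (Disjoint to Disjointˡ)
open import Data.List.Relation.Binary.Permutation.Propositional using (_↭_; ↭-sym; ↭⇒↭ₛ)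
open import Data.List.Relation.Binary.Permutation.Propositional.Properties
  using (++-comm; ∈-resp-↭) renaming (map⁺ to ↭-map⁺)
import Data.List.Relation.Binary.Permutation.Setoid.Properties as ↭ₛ
open import Data.List.Relation.Unary.All as All using ([]; _∷_)
import Data.List.Relation.Unary.All.Properties as All
open import Data.List.Relation.Unary.AllPairs as AllPairs using ([]; _∷_)
import Data.List.Relation.Unary.AllPairs.Properties as AllPairs
open import Data.List.Relation.Unary.Any using (Any; here; there; index)
open import Data.List.Relation.Unary.Any.Properties using (lookup-index)
open import Data.List.Relation.Unary.Unique.Propositional using (Unique)
import Data.List.Relation.Unary.Unique.Propositional.Properties as Unique
open import Data.Nat.Base as ℕ using (ℕ; zero; suc; s≤s⁻¹)
open import Data.Nat.Divisibility using (_∣_; _∣?_; divides; _∣0; ∣-refl; ∣m∣n⇒∣m+n)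
import Data.Nat.Properties as ℕ
open import Data.Product.Base using (∃; _×_; _,_; proj₁; proj₂)
open import Data.Sum.Base using (inj₁; inj₂)
open import Data.Unit.Base using (tt) renaming (⊤ to Unit)
open import Data.Vec.Base as Vec using (Vec; []; _∷_; here; there)
open import Data.Vec.Properties using (lookup∘tabulate; ∷-injective)
open import Function.Base using (_∘_)
open import Function.Bundles using (Injection; Inverse; mk⇔)
open import Function.Properties.Inverse using (↔⇒↣)
open import Level using (Level)
open import Relation.Binary.PropositionalEquality
  using (_≢_; refl; sym; trans; cong; cong₂; cong-app; subst; setoid; module ≡-Reasoning)
open import Relation.Nullary using (Dec; does; yes; no; ¬_; ¬?; contradiction; _×-dec_)
open import Relation.Nullary.Decidable using (dec-true; dec-false; does-⇔; decidable-stable)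
open import Relation.Unary using (Pred; Decidable)
open import Algebra.Properties.AbelianGroup ℤ.+-0-abelianGroup
  using (inverseˡ-unique)
open import Algebra.Properties.Semiring.Sum ℤ.+-*-semiring
  using (sum; sum-cong-≗; ∑-distrib-+; *-distribˡ-sum; sum-replicate-zero)

open ≡-Reasoning

private
  variable
    a b p r : Level
    A : Set a
    B : Set b
    m n : ℕ

-- Determinants

sum-zero : (f : Fin n → ℤ) → (∀ i → f i ≡ 0ℤ) → sum f ≡ 0ℤ
sum-zero {n} f f≗0 = trans (sum-cong-≗ f≗0) (sum-replicate-zero n)

sgn : Fin n → ℤ
sgn j = -1ℤ ^ toℕ j

-- The matrix M without its first row and its column j.
minor : Fin (suc n) → Matrix (suc n) → Matrix n
minor j M i l = M (suc i) (punchIn j l)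

-- The summand of index j in the Laplace expansion along the first row.
term : Matrix (suc n) → Fin (suc n) → ℤ
term M j = sgn j * (M zero j * det (minor j M))

det-cong : {M N : Matrix n} → (∀ i j → M i j ≡ N i j) → det M ≡ det N
det-cong {zero}  M≗N = refl
det-cong {suc n} M≗N = sum-cong-≗ λ j →
  cong (sgn j *_) (cong₂ _*_ (M≗N zero j)
    (det-cong λ i l → M≗N (suc i) (punchIn j l)))

-- The rows other than r agree in the three matrices.
det-additive : {L M N : Matrix n} (r : Fin n) →
  (∀ j → L r j ≡ M r j + N r j) →
  (∀ i → i ≢ r → ∀ j → M i j ≡ L i j) →
  (∀ i → i ≢ r → ∀ j → N i j ≡ L i j) →
  det L ≡ det M + det N
det-additive {suc n} {L} {M} {N} zero atr M≗L N≗L =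
  trans (sum-cong-≗ eq) (∑-distrib-+ (term M) (term N))
  where
  distrib : ∀ s x y d → s * ((x + y) * d) ≡ s * (x * d) + s * (y * d)
  distrib = solve-∀
  eq : ∀ j → term L j ≡ term M j + term N j
  eq j rewrite atr j = trans (distrib (sgn j) (M zero j) (N zero j) (det (minor j L)))
    (cong₂ _+_
      (cong (λ d → sgn j * (M zero j * d))
        (det-cong λ i l → sym (M≗L (suc i) (λ ()) (punchIn j l))))
      (cong (λ d → sgn j * (N zero j * d))
        (det-cong λ i l → sym (N≗L (suc i) (λ ()) (punchIn j l)))))
det-additive {suc n} {L} {M} {N} (suc r) atr M≗L N≗L =
  trans (sum-cong-≗ eq) (∑-distrib-+ (term M) (term N))
  where
  distrib : ∀ s x d e → s * (x * (d + e)) ≡ s * (x * d) + s * (x * e)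
  distrib = solve-∀
  eq : ∀ j → term L j ≡ term M j + term N j
  eq j rewrite M≗L zero (λ ()) j | N≗L zero (λ ()) j =
    trans
      (cong (λ d → sgn j * (L zero j * d))
        (det-additive r (λ l → atr (punchIn j l))
          (λ i i≢r l → M≗L (suc i) (i≢r ∘ suc-injective) (punchIn j l))
          (λ i i≢r l → N≗L (suc i) (i≢r ∘ suc-injective) (punchIn j l))))
      (distrib (sgn j) (L zero j) (det (minor j M)) (det (minor j N)))

infixl 6 _[_≔_]

-- The matrix M with row r replaced by u.
_[_≔_] : Matrix n → Fin n → (Fin n → ℤ) → Matrix n
(M [ r ≔ u ]) i = if does (i ≟ r) then u else M i

update-at : (M : Matrix n) (r : Fin n) (u : Fin n → ℤ) → (M [ r ≔ u ]) r ≡ u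
update-at M r u rewrite dec-true (r ≟ r) refl = refl

update-off : (M : Matrix n) (r : Fin n) (u : Fin n → ℤ) {i : Fin n} →
  i ≢ r → (M [ r ≔ u ]) i ≡ M i
update-off M r u {i} i≢r rewrite dec-false (i ≟ r) i≢r = refl

update-change : (M : Matrix n) (r : Fin n) (u w : Fin n → ℤ) →
  ∀ i → i ≢ r → ∀ j → (M [ r ≔ u ]) i j ≡ (M [ r ≔ w ]) i j
update-change M r u w i i≢r j rewrite dec-false (i ≟ r) i≢r = refl

det-update-+ : (M : Matrix n) (r : Fin n) (u w : Fin n → ℤ) →
  det (M [ r ≔ (λ j → u j + w j) ]) ≡ det (M [ r ≔ u ]) + det (M [ r ≔ w ])
det-update-+ M r u w = det-additive r
  (λ j → trans (cong-app (update-at M r _) j)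
    (sym (cong₂ _+_ (cong-app (update-at M r u) j) (cong-app (update-at M r w) j))))
  (update-change M r _ _) (update-change M r _ _)

-- The determinant of n by n matrices vanishes if two rows are equal. It is a
-- property of the size n because the proof alternates between this property for
-- one size and antisymmetry under row exchange for the same size.
Alternating : ℕ → Set
Alternating n = ∀ (M : Matrix n) r s → r ≢ s → (∀ j → M r j ≡ M s j) → det M ≡ 0ℤ

-- Bilinear expansion of a determinant in which both rows are replaced by their
-- sum.
swap-neg : Alternating n → ∀ (M N : Matrix n) {r s} → r ≢ s →
  (∀ j → N r j ≡ M s j) → (∀ j → N s j ≡ M r j) →
  (∀ i → i ≢ r → i ≢ s → ∀ j → N i j ≡ M i j) →
  det N ≡ - det M
swap-neg alt M N {r} {s} r≢s Nr Ns Noff = inverseˡ-unique _ _ (begin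
  det N + det M
    ≡⟨ cong₂ _+_ (det-cong N≗) (det-cong M≗) ⟩
  det (X σ ρ) + det (X ρ σ)
    ≡⟨ regroup (det (X ρ σ)) (det (X σ ρ)) ⟩
  (0ℤ + det (X ρ σ)) + (det (X σ ρ) + 0ℤ)
    ≡⟨ cong₂ (λ x y → (x + det (X ρ σ)) + (det (X σ ρ) + y)) (same ρ) (same σ) ⟨
  (det (X ρ ρ) + det (X ρ σ)) + (det (X σ ρ) + det (X σ σ))
    ≡⟨ cong₂ _+_ (right ρ) (right σ) ⟨
  det (X ρ ρ+σ) + det (X σ ρ+σ)
    ≡⟨ det-additive r (λ j → trans (Xr ρ+σ ρ+σ j) (sym (cong₂ _+_ (Xr ρ ρ+σ j) (Xr σ ρ+σ j))))
         (offr ρ ρ+σ ρ+σ) (offr σ ρ+σ ρ+σ) ⟨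
  det (X ρ+σ ρ+σ)
    ≡⟨ same ρ+σ ⟩
  0ℤ ∎)
  where
  ρ = M r
  σ = M s
  ρ+σ = λ j → M r j + M s j
  X : (u w : _ → ℤ) → Matrix _
  X u w = M [ r ≔ u ] [ s ≔ w ]
  regroup : ∀ x y → y + x ≡ (0ℤ + x) + (y + 0ℤ)
  regroup = solve-∀
  Xr : ∀ u w j → X u w r j ≡ u j
  Xr u w j = cong-app (trans (update-off (M [ r ≔ u ]) s w r≢s) (update-at M r u)) j
  Xs : ∀ u w j → X u w s j ≡ w j
  Xs u w j = cong-app (update-at (M [ r ≔ u ]) s w) j
  same : ∀ u → det (X u u) ≡ 0ℤ
  same u = alt (X u u) r s r≢s λ j → trans (Xr u u j) (sym (Xs u u j))
  right : ∀ u → det (X u ρ+σ) ≡ det (X u ρ) + det (X u σ)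
  right u = det-update-+ (M [ r ≔ u ]) s ρ σ
  offr : ∀ u u' w i → i ≢ r → ∀ j → X u w i j ≡ X u' w i j
  offr u u' w i i≢r j with i ≟ s
  ... | yes refl = refl
  ... | no _ rewrite dec-false (i ≟ r) i≢r = refl
  N≗ : ∀ i j → N i j ≡ X σ ρ i j
  N≗ i j with i ≟ s
  ... | yes refl = Ns j
  ... | no i≢s with i ≟ r
  ...   | yes refl = Nr j
  ...   | no i≢r = Noff i i≢r i≢s j
  M≗ : ∀ i j → M i j ≡ X ρ σ i j
  M≗ i j with i ≟ s
  ... | yes refl = refl
  ... | no i≢s with i ≟ r
  ...   | yes refl = refl
  ...   | no i≢r = refl

-- An ordered pair of distinct columns is encoded as (j , l), which stands for
-- column j followed by column punchIn j l. The same two columns in the opposite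
-- order are then encoded as (punchIn j l , pinch l j), by punchIn-pinch below.
sum-antisym : (F : Fin (suc n) → Fin n → ℤ) →
  (∀ j l → F j l + F (punchIn j l) (pinch l j) ≡ 0ℤ) →
  sum (λ j → sum (F j)) ≡ 0ℤ
sum-antisym {zero}  F anti = refl
sum-antisym {suc n} F anti = begin
  sum (F zero) + sum (λ j → F (suc j) zero + sum (λ l → F (suc j) (suc l)))
    ≡⟨ cong (λ x → sum (F zero) + x)
         (∑-distrib-+ (λ j → F (suc j) zero) (λ j → sum λ l → F (suc j) (suc l))) ⟩
  sum (F zero) + (sum (λ j → F (suc j) zero) + sum (λ j → sum λ l → F (suc j) (suc l)))
    ≡⟨ ℤ.+-assoc (sum (F zero)) _ _ ⟨
  (sum (F zero) + sum (λ j → F (suc j) zero)) + sum (λ j → sum λ l → F (suc j) (suc l))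
    ≡⟨ cong₂ _+_ (sym (∑-distrib-+ (F zero) λ j → F (suc j) zero))
         (sum-antisym (λ j l → F (suc j) (suc l)) λ j l → anti (suc j) (suc l)) ⟩
  sum (λ l → F zero l + F (suc l) zero) + 0ℤ
    ≡⟨ cong (_+ 0ℤ) (sum-zero _ λ l → anti zero l) ⟩
  0ℤ ∎

punchIn-pinch : (j : Fin (suc n)) (l : Fin n) → punchIn (punchIn j l) (pinch l j) ≡ j
punchIn-pinch {suc n} zero    l       = refl
punchIn-pinch {suc n} (suc j) zero    = refl
punchIn-pinch {suc n} (suc j) (suc l) = cong suc (punchIn-pinch j l)

punchIn-punchIn : (j : Fin (suc (suc n))) (l : Fin (suc n)) (t : Fin n) →
  punchIn (punchIn j l) (punchIn (pinch l j) t) ≡ punchIn j (punchIn l t)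
punchIn-punchIn zero    l       t       = refl
punchIn-punchIn (suc j) zero    t       = refl
punchIn-punchIn (suc j) (suc l) zero    = refl
punchIn-punchIn (suc j) (suc l) (suc t) = cong suc (punchIn-punchIn j l t)

sgn-pinch : (j : Fin (suc n)) (l : Fin n) →
  sgn (punchIn j l) * sgn (pinch l j) ≡ - (sgn j * sgn l)
sgn-pinch {suc n} zero l = eq (sgn l)
  where
  eq : ∀ s → (-1ℤ * s) * 1ℤ ≡ - (1ℤ * s)
  eq = solve-∀
sgn-pinch {suc n} (suc j) zero = eq (sgn j)
  where
  eq : ∀ s → 1ℤ * s ≡ - ((-1ℤ * s) * 1ℤ)
  eq = solve-∀
sgn-pinch {suc n} (suc j) (suc l) =
  trans (eq (sgn (punchIn j l)) (sgn (pinch l j)))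
    (trans (sgn-pinch j l) (cong -_ (sym (eq (sgn j) (sgn l)))))
  where
  eq : ∀ s t → (-1ℤ * s) * (-1ℤ * t) ≡ s * t
  eq = solve-∀

-- Expanding along the first two rows gives a sum over ordered pairs of distinct
-- columns. Exchanging the two columns leaves the entries and the remaining minor
-- unchanged and reverses the sign.
det-first-rows-equal : (M : Matrix (suc (suc n))) →
  (∀ j → M zero j ≡ M (suc zero) j) → det M ≡ 0ℤ
det-first-rows-equal {n} M M₀≗M₁ =
  trans (sum-cong-≗ expand) (sum-antisym F anti)
  where
  D : Fin (suc (suc n)) → Fin (suc n) → ℤ
  D j l = det (minor l (minor j M))
  F : Fin (suc (suc n)) → Fin (suc n) → ℤ
  F j l = (sgn j * sgn l) * ((M zero j * M zero (punchIn j l)) * D j l)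
  assoc : ∀ s a t b d → (s * a) * (t * (b * d)) ≡ (s * t) * ((a * b) * d)
  assoc = solve-∀
  expand : ∀ j → term M j ≡ sum (F j)
  expand j = begin
    sgn j * (M zero j * det (minor j M))
      ≡⟨ ℤ.*-assoc (sgn j) _ _ ⟨
    (sgn j * M zero j) * det (minor j M)
      ≡⟨ *-distribˡ-sum (sgn j * M zero j) (term (minor j M)) ⟩
    sum (λ l → (sgn j * M zero j) * term (minor j M) l)
      ≡⟨ sum-cong-≗ (λ l → trans (assoc (sgn j) (M zero j) (sgn l) (minor j M zero l) (D j l))
           (cong (λ b → (sgn j * sgn l) * ((M zero j * b) * D j l))
             (sym (M₀≗M₁ (punchIn j l))))) ⟩
    sum (F j) ∎
  cancel : ∀ s a b d → s * ((a * b) * d) + (- s) * ((b * a) * d) ≡ 0ℤ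
  cancel = solve-∀
  anti : ∀ j l → F j l + F (punchIn j l) (pinch l j) ≡ 0ℤ
  anti j l = trans
    (cong (λ x → F j l + x) (cong₂ _*_ (sgn-pinch j l) (cong₂ _*_
      (cong (λ c → M zero (punchIn j l) * M zero c) (punchIn-pinch j l))
      (det-cong λ i t → cong (M (suc (suc i))) (punchIn-punchIn j l t)))))
    (cancel (sgn j * sgn l) (M zero j) (M zero (punchIn j l)) (D j l))

-- A repetition of the first row lower down is moved to the second row by a row
-- exchange, which takes place inside the minors of the first row.
det-first-row-repeated : Alternating n → (M : Matrix (suc n)) (s : Fin n) →
  (∀ j → M zero j ≡ M (suc s) j) → det M ≡ 0ℤ
det-first-row-repeated alt M zero    eq = det-first-rows-equal M eq
det-first-row-repeated alt M (suc s) eq = begin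
  det M      ≡⟨ ℤ.neg-involutive (det M) ⟨
  - - det M  ≡⟨ cong -_ det-N ⟨
  - det N    ≡⟨ cong -_ (det-first-rows-equal N eq) ⟩
  0ℤ         ∎
  where
  -- M with the rows suc zero and suc (suc s) exchanged
  M′ N : Matrix _
  M′ = M [ suc zero ≔ M (suc (suc s)) ]
  N  = M′ [ suc (suc s) ≔ M (suc zero) ]
  flip : ∀ s a d → s * (a * - d) ≡ -1ℤ * (s * (a * d))
  flip = solve-∀
  minor-N : ∀ j → det (minor j N) ≡ - det (minor j M)
  minor-N j = swap-neg alt (minor j M) (minor j N) {r = zero} {s = suc s} (λ ())
    (λ l → refl)
    (λ l → cong-app (update-at M′ (suc (suc s)) (M (suc zero))) (punchIn j l))
    (λ { zero    0≢0 _   l → ⊥-elim (0≢0 refl)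
       ; (suc i) _   i≢s l → cong-app
           (update-off M′ (suc (suc s)) (M (suc zero)) (i≢s ∘ suc-injective))
           (punchIn j l) })
  step : ∀ j → term N j ≡ -1ℤ * term M j
  step j = trans (cong (λ d → sgn j * (M zero j * d)) (minor-N j))
    (flip (sgn j) (M zero j) (det (minor j M)))
  det-N : det N ≡ - det M
  det-N = trans (sum-cong-≗ step)
    (trans (sym (*-distribˡ-sum -1ℤ (term M))) (ℤ.-1*i≡-i (det M)))

det-alternating : Alternating n
det-alternating M zero    zero    r≢s eq = ⊥-elim (r≢s refl)
det-alternating M zero    (suc s) r≢s eq = det-first-row-repeated det-alternating M s eq
det-alternating M (suc r) zero    r≢s eq =
  det-first-row-repeated det-alternating M r (sym ∘ eq)
det-alternating M (suc r) (suc s) r≢s eq = sum-zero (term M) λ j →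
  trans (cong (λ d → sgn j * (M zero j * d))
      (det-alternating (minor j M) r s (r≢s ∘ cong suc) λ l → eq (punchIn j l)))
    (vanish (sgn j) (M zero j))
  where
  vanish : ∀ s a → s * (a * 0ℤ) ≡ 0ℤ
  vanish = solve-∀

det-swap : (M N : Matrix n) {r s : Fin n} → r ≢ s →
  (∀ j → N r j ≡ M s j) → (∀ j → N s j ≡ M r j) →
  (∀ i → i ≢ r → i ≢ s → ∀ j → N i j ≡ M i j) →
  det N ≡ - det M
det-swap = swap-neg det-alternating

det-identity : det (identity {n}) ≡ 1ℤ
det-identity {zero}  = refl
det-identity {suc n} =
  cong₂ _+_ (trans (unit (det (identity {n}))) (det-identity {n}))
    (sum-zero (λ j → term (identity {suc n}) (suc j)) λ j →
      vanish (sgn (suc j)) (det (minor (suc j) (identity {suc n}))))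
  where
  unit : ∀ d → 1ℤ * (1ℤ * d) ≡ d
  unit = solve-∀
  vanish : ∀ s d → s * (0ℤ * d) ≡ 0ℤ
  vanish = solve-∀

-- Finite sums over lists

-- The sum of f over a list.
total : (A → ℤ) → List A → ℤ
total f xs = foldr _+_ 0ℤ (map f xs)

total-cong-∈ : {f g : A → ℤ} (xs : List A) → (∀ {x} → x ∈ˡ xs → f x ≡ g x) →
  total f xs ≡ total g xs
total-cong-∈ []       f≗g = refl
total-cong-∈ (x ∷ xs) f≗g = cong₂ _+_ (f≗g (here refl)) (total-cong-∈ xs (f≗g ∘ there))

total-cong : {f g : A → ℤ} (xs : List A) → (∀ x → f x ≡ g x) → total f xs ≡ total g xs
total-cong xs f≗g = total-cong-∈ xs λ {x} _ → f≗g x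

total-map : (f : B → ℤ) (g : A → B) (xs : List A) → total f (map g xs) ≡ total (f ∘ g) xs
total-map f g xs = cong (foldr _+_ 0ℤ) (sym (map-∘ xs))

total-++ : (f : A → ℤ) (xs ys : List A) → total f (xs ++ ys) ≡ total f xs + total f ys
total-++ f []       ys = sym (ℤ.+-identityˡ _)
total-++ f (x ∷ xs) ys =
  trans (cong (λ t → f x + t) (total-++ f xs ys)) (sym (ℤ.+-assoc (f x) _ _))

total-concatMap : (f : B → ℤ) (g : A → List B) (xs : List A) →
  total f (concatMap g xs) ≡ total (total f ∘ g) xs
total-concatMap f g []       = refl
total-concatMap f g (x ∷ xs) =
  trans (total-++ f (g x) _) (cong (λ t → total f (g x) + t) (total-concatMap f g xs))

total-minus : (f g : A → ℤ) (xs : List A) →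
  total (λ x → f x - g x) xs ≡ total f xs - total g xs
total-minus f g []       = refl
total-minus f g (x ∷ xs) =
  trans (cong (λ t → (f x - g x) + t) (total-minus f g xs))
    (regroup (f x) (g x) (total f xs) (total g xs))
  where
  regroup : ∀ s t u v → (s - t) + (u - v) ≡ (s + u) - (t + v)
  regroup = solve-∀

total-neg : (f : A → ℤ) (xs : List A) → total (λ x → - f x) xs ≡ - total f xs
total-neg f []       = refl
total-neg f (x ∷ xs) = trans (cong (λ t → - f x + t) (total-neg f xs))
  (sym (ℤ.neg-distrib-+ (f x) (total f xs)))

total-filter : {P : Pred A p} (P? : Decidable P) (f : A → ℤ) (xs : List A) →
  total f (filter P? xs) ≡ total (λ x → if does (P? x) then f x else 0ℤ) xs
total-filter P? f []       = refl
total-filter P? f (x ∷ xs) with does (P? x)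
... | true  = cong (λ t → f x + t) (total-filter P? f xs)
... | false = trans (total-filter P? f xs) (sym (ℤ.+-identityˡ _))

total-↭ : (f : A → ℤ) {xs ys : List A} → xs ↭ ys → total f xs ≡ total f ys
total-↭ f xs↭ys = ↭ₛ.foldr-commMonoid (setoid ℤ) ℤ.+-0-isCommutativeMonoid
  (↭⇒↭ₛ (↭-map⁺ f xs↭ys))

-- Expanding a determinant along a row that is a sum

det-update-cong : (M : Matrix n) (r : Fin n) {u w : Fin n → ℤ} → (∀ j → u j ≡ w j) →
  det (M [ r ≔ u ]) ≡ det (M [ r ≔ w ])
det-update-cong M r {u} {w} u≗w = det-cong eq
  where
  eq : ∀ i j → (M [ r ≔ u ]) i j ≡ (M [ r ≔ w ]) i j
  eq i j with does (i ≟ r)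
  ... | true  = u≗w j
  ... | false = refl

det-update-total : (M : Matrix n) (r : Fin n) (c : Fin n → ℤ) (u : A → Fin n → ℤ)
  (xs : List A) →
  det (M [ r ≔ (λ j → c j - total (λ x → u x j) xs) ]) ≡
  det (M [ r ≔ c ]) - total (λ x → det (M [ r ≔ u x ])) xs
det-update-total M r c u [] = trans
  (det-update-cong M r λ j → ℤ.+-identityʳ (c j)) (sym (ℤ.+-identityʳ _))
det-update-total M r c u (x ∷ xs) = begin
  det (M [ r ≔ lhs ])
    ≡⟨ cancel _ (det (M [ r ≔ u x ])) ⟩
  (det (M [ r ≔ lhs ]) + det (M [ r ≔ u x ])) - det (M [ r ≔ u x ])
    ≡⟨ cong (_- det (M [ r ≔ u x ])) (det-update-+ M r lhs (u x)) ⟨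
  det (M [ r ≔ (λ j → lhs j + u x j) ]) - det (M [ r ≔ u x ])
    ≡⟨ cong (_- det (M [ r ≔ u x ]))
         (det-update-cong M r λ j → restore (c j) (u x j) (total (λ y → u y j) xs)) ⟩
  det (M [ r ≔ (λ j → c j - total (λ y → u y j) xs) ]) - det (M [ r ≔ u x ])
    ≡⟨ cong (_- det (M [ r ≔ u x ])) (det-update-total M r c u xs) ⟩
  (det (M [ r ≔ c ]) - total (λ y → det (M [ r ≔ u y ])) xs) - det (M [ r ≔ u x ])
    ≡⟨ regroup (det (M [ r ≔ c ])) _ (det (M [ r ≔ u x ])) ⟩
  det (M [ r ≔ c ]) - (det (M [ r ≔ u x ]) + total (λ y → det (M [ r ≔ u y ])) xs) ∎
  where
  lhs : Fin _ → ℤ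
  lhs j = c j - total (λ y → u y j) (x ∷ xs)
  cancel : ∀ s t → s ≡ (s + t) - t
  cancel = solve-∀
  restore : ∀ s t v → (s - (t + v)) + t ≡ s - v
  restore = solve-∀
  regroup : ∀ s t v → (s - t) - v ≡ s - (v + t)
  regroup = solve-∀

-- Expanding the determinant of I - A along paths

x∈p─q⇒x∉q : (P Q : Subset n) {x : Fin n} → x ∈ P ─ Q → x ∉ Q
x∈p─q⇒x∉q (_ ∷ P) (true  ∷ Q) (there x∈) (there x∈Q) = x∈p─q⇒x∉q P Q x∈ x∈Q
x∈p─q⇒x∉q (_ ∷ P) (false ∷ Q) (there x∈) (there x∈Q) = x∈p─q⇒x∉q P Q x∈ x∈Q

x∉p∖x : (P : Subset n) (x : Fin n) → x ∉ P ∖ x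
x∉p∖x P x x∈ = x∈p─q⇒x∉q P ⁅ x ⁆ x∈ (x∈⁅x⁆ x)

-- The set of elements of a list.
toSet : List (Fin n) → Subset n
toSet = foldr (λ x S → ⁅ x ⁆ ∪ S) ⊥

-- A graph on the vertices Fin n with edges Fin m, src and tgt being the source
-- and range maps.
module Digraph (src tgt : Fin m → Fin n) where

  -- The edges with source w.
  out : Fin n → List (Fin m)
  out w = filter (λ e → src e ≟ w) (allFin m)

  ∈-out⁺ : ∀ {e w} → src e ≡ w → e ∈ˡ out w
  ∈-out⁺ {e} {w} eq = ∈-filter⁺ (λ e → src e ≟ w) (∈-allFin e) eq

  ∈-out⁻ : ∀ {e w} → e ∈ˡ out w → src e ≡ w
  ∈-out⁻ {e} {w} e∈ = proj₂ (∈-filter⁻ (λ e → src e ≟ w) {xs = allFin m} e∈)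

  -- The rows of I - A: row i is a unit vector minus the unit vectors of the ranges
  -- of the edges that leave i.
  row : Fin n → Fin n → ℤ
  row i j = identity i j - total (λ e → identity (tgt e) j) (out i)

  -- The matrix I - A of the graph from which all edges with source outside S are
  -- removed. Since its rows outside S are unit vectors, its determinant is the
  -- principal minor of I - A on S; this avoids submatrices.
  restrict : Subset n → Matrix n
  restrict S i = if does (i ∈? S) then row i else identity i

  detOn : Subset n → ℤ
  detOn S = det (restrict S)

  -- For v outside S, row v of restrict S is replaced by the unit vector of w.
  -- This is what remains of the expansion after a path from v to w has been
  -- followed, S being the set of vertices not yet used.
  detTo : Subset n → Fin n → Fin n → ℤ
  detTo S v w = det (restrict S [ v ≔ identity w ])

  restrict-∈ : ∀ {S i} → i ∈ S → restrict S i ≡ row i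
  restrict-∈ {S} {i} i∈S rewrite dec-true (i ∈? S) i∈S = refl

  restrict-∉ : ∀ {S i} → i ∉ S → restrict S i ≡ identity i
  restrict-∉ {S} {i} i∉S rewrite dec-false (i ∈? S) i∉S = refl

  restrict-∖ : ∀ S {i v} → i ≢ v → restrict (S ∖ v) i ≡ restrict S i
  restrict-∖ S {i} {v} i≢v with i ∈? S
  ... | yes i∈S = restrict-∈ (x∈p∧x≢y⇒x∈p-y i∈S i≢v)
  ... | no  i∉S = restrict-∉ (i∉S ∘ p─q⊆p S ⁅ v ⁆)

  detTo-diagonal : ∀ {S v} → v ∉ S → detTo S v v ≡ detOn S
  detTo-diagonal {S} {v} v∉S = det-cong eq
    where
    eq : ∀ i j → (restrict S [ v ≔ identity v ]) i j ≡ restrict S i j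
    eq i j with i ≟ v
    ... | yes refl = sym (cong-app (restrict-∉ v∉S) j)
    ... | no  _    = refl

  detOn-expand : ∀ {S v} → v ∈ S →
    detOn S ≡ detOn (S ∖ v) - total (λ e → detTo (S ∖ v) v (tgt e)) (out v)
  detOn-expand {S} {v} v∈S = begin
    detOn S
      ≡⟨ det-cong eq ⟩
    det (restrict (S ∖ v) [ v ≔ row v ])
      ≡⟨ det-update-total (restrict (S ∖ v)) v (identity v) (identity ∘ tgt) (out v) ⟩
    detTo (S ∖ v) v v - total (λ e → detTo (S ∖ v) v (tgt e)) (out v)
      ≡⟨ cong (_- total (λ e → detTo (S ∖ v) v (tgt e)) (out v)) (detTo-diagonal (x∉p∖x S v)) ⟩
    detOn (S ∖ v) - total (λ e → detTo (S ∖ v) v (tgt e)) (out v) ∎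
    where
    eq : ∀ i j → restrict S i j ≡ (restrict (S ∖ v) [ v ≔ row v ]) i j
    eq i j with i ≟ v
    ... | yes refl = cong-app (restrict-∈ v∈S) j
    ... | no  i≢v  = cong-app (sym (restrict-∖ S i≢v)) j

  detTo-∉ : ∀ {S v w} → w ≢ v → w ∉ S → detTo S v w ≡ 0ℤ
  detTo-∉ {S} {v} {w} w≢v w∉S = det-alternating _ v w (w≢v ∘ sym) λ j →
    cong-app (trans (update-at (restrict S) v (identity w))
      (sym (trans (update-off (restrict S) v (identity w) w≢v) (restrict-∉ w∉S)))) j

  -- The path is prolonged by one edge leaving w. In the expansion along row w the
  -- unit vector of w itself contributes nothing, since row v already equals it; the
  -- term of an edge e has its rows v and w exchanged, and the resulting sign
  -- cancels the minus sign of the edge.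
  detTo-expand : ∀ {S v w} → w ≢ v → w ∈ S →
    detTo S v w ≡ total (λ e → detTo (S ∖ w) v (tgt e)) (out w)
  detTo-expand {S} {v} {w} w≢v w∈S = begin
    det X
      ≡⟨ det-cong eq ⟩
    det (X [ w ≔ row w ])
      ≡⟨ det-update-total X w (identity w) (identity ∘ tgt) (out w) ⟩
    det (X [ w ≔ identity w ]) - total (λ e → det (X [ w ≔ identity (tgt e) ])) (out w)
      ≡⟨ cong₂ _-_ repeated (trans (total-cong (out w) swapped)
           (total-neg (λ e → detTo (S ∖ w) v (tgt e)) (out w))) ⟩
    0ℤ - - total (λ e → detTo (S ∖ w) v (tgt e)) (out w)
      ≡⟨ simplify _ ⟩
    total (λ e → detTo (S ∖ w) v (tgt e)) (out w) ∎
    where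
    X : Matrix _
    X = restrict S [ v ≔ identity w ]
    v≢w : v ≢ w
    v≢w = w≢v ∘ sym
    simplify : ∀ t → 0ℤ - - t ≡ t
    simplify = solve-∀
    eq : ∀ i j → X i j ≡ (X [ w ≔ row w ]) i j
    eq i j with i ≟ w
    ... | yes refl =
      cong-app (trans (update-off (restrict S) v (identity w) w≢v) (restrict-∈ w∈S)) j
    ... | no  _    = refl
    X-v : ∀ u → (X [ w ≔ u ]) v ≡ identity w
    X-v u = trans (update-off X w u v≢w) (update-at (restrict S) v (identity w))
    repeated : det (X [ w ≔ identity w ]) ≡ 0ℤ
    repeated = det-alternating _ v w v≢w λ j →
      cong-app (trans (X-v (identity w)) (sym (update-at X w (identity w)))) j
    -- Exchanging the rows v and w gives the matrix of detTo (S ∖ w) v (tgt e).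
    swapped : ∀ e → det (X [ w ≔ identity (tgt e) ]) ≡ - detTo (S ∖ w) v (tgt e)
    swapped e = det-swap Y _ v≢w
      (λ j → cong-app (trans (X-v (identity (tgt e)))
        (sym (trans (update-off (restrict (S ∖ w)) v (identity (tgt e)) w≢v)
          (restrict-∉ (x∉p∖x S w))))) j)
      (λ j → cong-app (trans (update-at X w (identity (tgt e)))
        (sym (update-at (restrict (S ∖ w)) v (identity (tgt e))))) j)
      λ i i≢v i≢w j → cong-app (trans (update-off X w (identity (tgt e)) i≢w)
        (trans (update-off (restrict S) v (identity w) i≢v)
          (sym (trans (update-off (restrict (S ∖ w)) v (identity (tgt e)) i≢v)
            (restrict-∖ S i≢w))))) j
      where
      Y : Matrix _
      Y = restrict (S ∖ w) [ v ≔ identity (tgt e) ]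

  -- For w in S, paths k S v w lists the edge sequences of the paths from w to v with
  -- pairwise distinct sources in S that stop at their first arrival in v; for w = v these
  -- are the cycles through v. The number k bounds their length, and the list is
  -- complete as soon as S has at most k elements. pathsVia collects the paths
  -- with a given first edge.
  mutual
    paths : ℕ → Subset n → Fin n → Fin n → List (List (Fin m))
    paths zero    S v w = []
    paths (suc k) S v w = concatMap (pathsVia k S v w) (out w)

    pathsVia : ℕ → Subset n → Fin n → Fin n → Fin m → List (List (Fin m))
    pathsVia k S v w e =
      if does (tgt e ≟ v) then (e ∷ []) ∷ []
      else if does (tgt e ∈? S ∖ w) then map (e ∷_) (paths k (S ∖ w) v (tgt e))
      else []

  -- The set of sources of a list of edges.
  visited : List (Fin m) → Subset n
  visited es = toSet (map src es)

  -- The hypothesis on v covers both the start of a cycle, w = v, and the later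
  -- steps, in which v is not in S.
  path-sum : ∀ k S v w → ∣ S ∣ ℕ.≤ k → w ∈ S → v ∉ S ∖ w →
    total (λ e → detTo (S ∖ w) v (tgt e)) (out w) ≡
    total (λ es → detOn (S ─ visited es)) (paths k S v w)
  path-sum zero S v w ∣S∣≤0 w∈S v∉ =
    contradiction (ℕ.<-≤-trans (x∈p⇒∣p-x∣<∣p∣ w∈S) ∣S∣≤0) λ ()
  path-sum (suc k) S v w ∣S∣≤1+k w∈S v∉ =
    trans (total-cong-∈ (out w) λ e∈ → eq _ (∈-out⁻ e∈))
      (sym (total-concatMap (λ es → detOn (S ─ visited es)) (pathsVia k S v w) (out w)))
    where
    eq : ∀ e → src e ≡ w →
      detTo (S ∖ w) v (tgt e) ≡ total (λ es → detOn (S ─ visited es)) (pathsVia k S v w e)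
    eq e refl with tgt e ≟ v
    ... | yes refl = trans (detTo-diagonal v∉)
      (sym (trans (ℤ.+-identityʳ _) (cong (λ T → detOn (S ─ T)) (∪-identityʳ ⁅ src e ⁆))))
    ... | no tgt≢v with tgt e ∈? S ∖ w
    ...   | no tgt∉ = detTo-∉ tgt≢v tgt∉
    ...   | yes tgt∈ = begin
      detTo (S ∖ w) v (tgt e)
        ≡⟨ detTo-expand tgt≢v tgt∈ ⟩
      total (λ e′ → detTo (S ∖ w ∖ tgt e) v (tgt e′)) (out (tgt e))
        ≡⟨ path-sum k (S ∖ w) v (tgt e)
             (s≤s⁻¹ (ℕ.≤-trans (x∈p⇒∣p-x∣<∣p∣ w∈S) ∣S∣≤1+k)) tgt∈
             (v∉ ∘ p─q⊆p (S ∖ w) ⁅ tgt e ⁆) ⟩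
      total (λ es → detOn (S ∖ w ─ visited es)) (paths k (S ∖ w) v (tgt e))
        ≡⟨ total-cong (paths k (S ∖ w) v (tgt e))
             (λ es → cong detOn (p─q─r≡p─q∪r S ⁅ w ⁆ (visited es))) ⟩
      total (λ es → detOn (S ─ visited (e ∷ es))) (paths k (S ∖ w) v (tgt e))
        ≡⟨ total-map (λ es → detOn (S ─ visited es)) (e ∷_) (paths k (S ∖ w) v (tgt e)) ⟨
      total (λ es → detOn (S ─ visited es)) (map (e ∷_) (paths k (S ∖ w) v (tgt e))) ∎

  detOn-recursion : ∀ {S v} → v ∈ S →
    detOn S ≡ detOn (S ∖ v) - total (λ es → detOn (S ─ visited es)) (paths ∣ S ∣ S v v)
  detOn-recursion {S} {v} v∈S = trans (detOn-expand v∈S)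
    (cong (λ t → detOn (S ∖ v) - t) (path-sum ∣ S ∣ S v v ℕ.≤-refl v∈S (x∉p∖x S v)))

-- Signed counts and packings

-1^even : ∀ {k} → 2 ∣ k → -1ℤ ^ k ≡ 1ℤ
-1^even (divides q refl) = go q
  where
  twice : ∀ t → -1ℤ * (-1ℤ * t) ≡ t
  twice = solve-∀
  go : ∀ q → -1ℤ ^ (q ℕ.* 2) ≡ 1ℤ
  go zero    = refl
  go (suc q) = trans (twice _) (go q)

-1^odd : ∀ k → ¬ 2 ∣ k → -1ℤ ^ k ≡ -1ℤ
-1^odd zero          2∤k = contradiction (2 ∣0) 2∤k
-1^odd (suc zero)    2∤k = refl
-1^odd (suc (suc k)) 2∤k =
  trans (twice _) (-1^odd k (2∤k ∘ ∣m∣n⇒∣m+n ∣-refl))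
  where
  twice : ∀ t → -1ℤ * (-1ℤ * t) ≡ t
  twice = solve-∀

-- The elements of P that satisfy R, minus those that do not, as a sum of signs s.
signed-count : {P : Pred A p} {R : Pred A r} (P? : Decidable P) (R? : Decidable R)
  (s : A → ℤ) → (∀ {x} → R x → s x ≡ 1ℤ) → (∀ {x} → ¬ R x → s x ≡ -1ℤ) → ∀ xs →
  + length (filter (λ x → P? x ×-dec R? x) xs)
    - + length (filter (λ x → P? x ×-dec ¬? (R? x)) xs) ≡
  total (λ x → if does (P? x) then s x else 0ℤ) xs
signed-count {A = A} P? R? s s⁺ s⁻ = go
  where
  #⁺ #⁻ : List A → ℕ
  #⁺ xs = length (filter (λ x → P? x ×-dec R? x) xs)
  #⁻ xs = length (filter (λ x → P? x ×-dec ¬? (R? x)) xs)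
  regroup : ∀ t u → t - (1ℤ + u) ≡ -1ℤ + (t - u)
  regroup = solve-∀
  go : ∀ xs → + #⁺ xs - + #⁻ xs ≡ total (λ x → if does (P? x) then s x else 0ℤ) xs
  go [] = refl
  go (x ∷ xs) with does (P? x) | R? x
  ... | false | _      = trans (go xs) (sym (ℤ.+-identityˡ _))
  ... | true  | yes Rx =
    trans (ℤ.+-assoc 1ℤ (+ #⁺ xs) (- + #⁻ xs)) (cong₂ _+_ (sym (s⁺ Rx)) (go xs))
  ... | true  | no ¬Rx =
    trans (regroup (+ #⁺ xs) (+ #⁻ xs)) (cong₂ _+_ (sym (s⁻ ¬Rx)) (go xs))

-- A family of objects c occupying the vertex sets V c; a packing is a selection of
-- objects whose vertex sets are pairwise disjoint.
module Packings (V : A → Subset n) where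

  -- The positions 𝒞 in the list cs select objects that lie in S and are pairwise
  -- disjoint. Each selected object is removed from S before the rest of the list is
  -- considered, which gives the recursion of packingSum.
  Packing : (cs : List A) → Subset n → Subset (length cs) → Set
  Packing []       S []            = Unit
  Packing (c ∷ cs) S (inside  ∷ 𝒞) = V c ⊆ S × Packing cs (S ─ V c) 𝒞
  Packing (c ∷ cs) S (outside ∷ 𝒞) = Packing cs S 𝒞

  packing? : ∀ cs S → Decidable (Packing cs S)
  packing? []       S []            = yes tt
  packing? (c ∷ cs) S (inside  ∷ 𝒞) = (V c ⊆? S) ×-dec packing? cs (S ─ V c) 𝒞
  packing? (c ∷ cs) S (outside ∷ 𝒞) = packing? cs S 𝒞

  packing⇒⊆ : ∀ cs {S 𝒞} → Packing cs S 𝒞 → ∀ {i} → i ∈ 𝒞 → V (lookup cs i) ⊆ S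
  packing⇒⊆ (c ∷ cs) {S} {inside ∷ 𝒞} (c⊆S , _) here = c⊆S
  packing⇒⊆ (c ∷ cs) {S} {inside ∷ 𝒞} (_ , rest) (there i∈) =
    p─q⊆p S (V c) ∘ packing⇒⊆ cs rest i∈
  packing⇒⊆ (c ∷ cs) {S} {outside ∷ 𝒞} rest (there i∈) = packing⇒⊆ cs rest i∈

  Disjoint : (cs : List A) → Subset (length cs) → Set
  Disjoint cs 𝒞 = ∀ i j → i ∈ 𝒞 → j ∈ 𝒞 → i ≢ j →
    ∀ {x} → x ∈ V (lookup cs i) → x ∉ V (lookup cs j)

  packing⇒disjoint : ∀ cs {S 𝒞} → Packing cs S 𝒞 → Disjoint cs 𝒞
  packing⇒disjoint (c ∷ cs) pk zero zero i∈ j∈ i≢j = ⊥-elim (i≢j refl)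
  packing⇒disjoint (c ∷ cs) {S} {inside ∷ 𝒞} (_ , rest) zero (suc j) i∈ (there j∈) i≢j x∈c x∈ =
    x∈p─q⇒x∉q S (V c) (packing⇒⊆ cs rest j∈ x∈) x∈c
  packing⇒disjoint (c ∷ cs) {S} {inside ∷ 𝒞} (_ , rest) (suc i) zero (there i∈) j∈ i≢j x∈ x∈c =
    x∈p─q⇒x∉q S (V c) (packing⇒⊆ cs rest i∈ x∈) x∈c
  packing⇒disjoint (c ∷ cs) {S} {inside ∷ 𝒞} (_ , rest) (suc i) (suc j) (there i∈) (there j∈) i≢j =
    packing⇒disjoint cs rest i j i∈ j∈ (i≢j ∘ cong suc)
  packing⇒disjoint (c ∷ cs) {S} {outside ∷ 𝒞} rest (suc i) (suc j) (there i∈) (there j∈) i≢j =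
    packing⇒disjoint cs rest i j i∈ j∈ (i≢j ∘ cong suc)

  disjoint⇒packing : ∀ cs {S 𝒞} → (∀ i → i ∈ 𝒞 → V (lookup cs i) ⊆ S) → Disjoint cs 𝒞 →
    Packing cs S 𝒞
  disjoint⇒packing []       {𝒞 = []}          inS disj = tt
  disjoint⇒packing (c ∷ cs) {𝒞 = inside ∷ 𝒞}  inS disj =
    inS zero here ,
    disjoint⇒packing cs
      (λ i i∈ x∈ → x∈p∧x∉q⇒x∈p─q (inS (suc i) (there i∈) x∈)
        (disj (suc i) zero (there i∈) here (λ ()) x∈))
      (λ i j i∈ j∈ i≢j → disj (suc i) (suc j) (there i∈) (there j∈) (i≢j ∘ suc-injective))
  disjoint⇒packing (c ∷ cs) {𝒞 = outside ∷ 𝒞} inS disj =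
    disjoint⇒packing cs (λ i i∈ → inS (suc i) (there i∈))
      (λ i j i∈ j∈ i≢j → disj (suc i) (suc j) (there i∈) (there j∈) (i≢j ∘ suc-injective))

  -- The sum of the signs -1 ^ ∣ 𝒞 ∣ over all packings 𝒞 in S, as packingSum-counts
  -- shows.
  packingSum : List A → Subset n → ℤ
  packingSum []       S = 1ℤ
  packingSum (c ∷ cs) S =
    if does (V c ⊆? S) then packingSum cs S - packingSum cs (S ─ V c) else packingSum cs S

  packingSum-⊆ : ∀ {c S} cs → V c ⊆ S →
    packingSum (c ∷ cs) S ≡ packingSum cs S - packingSum cs (S ─ V c)
  packingSum-⊆ {c} {S} cs c⊆S rewrite dec-true (V c ⊆? S) c⊆S = refl

  packingSum-⊈ : ∀ {c S} cs → ¬ V c ⊆ S → packingSum (c ∷ cs) S ≡ packingSum cs S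
  packingSum-⊈ {c} {S} cs c⊈S rewrite dec-false (V c ⊆? S) c⊈S = refl

  packingSum-empty : ∀ {S} → Empty S → ∀ cs → (∀ {c} → c ∈ˡ cs → Nonempty (V c)) →
    packingSum cs S ≡ 1ℤ
  packingSum-empty S-empty []       nonempty = refl
  packingSum-empty S-empty (c ∷ cs) nonempty =
    trans (packingSum-⊈ cs λ c⊆S → let v , v∈c = nonempty (here refl) in S-empty (v , c⊆S v∈c))
      (packingSum-empty S-empty cs (nonempty ∘ there))

  -- The contribution of 𝒞 to the signed count of packings.
  weight : ∀ cs → Subset n → Subset (length cs) → ℤ
  weight cs S 𝒞 = if does (packing? cs S 𝒞) then -1ℤ ^ ∣ 𝒞 ∣ else 0ℤ

  packingSum-counts : ∀ cs S → total (weight cs S) (subsets (length cs)) ≡ packingSum cs S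
  packingSum-counts []       S = refl
  packingSum-counts (c ∷ cs) S = begin
    total (weight (c ∷ cs) S) (map (inside ∷_) Ss ++ map (outside ∷_) Ss)
      ≡⟨ total-++ (weight (c ∷ cs) S) (map (inside ∷_) Ss) _ ⟩
    total (weight (c ∷ cs) S) (map (inside ∷_) Ss) + total (weight (c ∷ cs) S) (map (outside ∷_) Ss)
      ≡⟨ cong₂ _+_ (total-map (weight (c ∷ cs) S) (inside ∷_) Ss)
           (total-map (weight (c ∷ cs) S) (outside ∷_) Ss) ⟩
    total (λ 𝒞 → weight (c ∷ cs) S (inside ∷ 𝒞)) Ss + total (weight cs S) Ss
      ≡⟨ cong (λ t → total (λ 𝒞 → weight (c ∷ cs) S (inside ∷ 𝒞)) Ss + t)
           (packingSum-counts cs S) ⟩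
    total (λ 𝒞 → weight (c ∷ cs) S (inside ∷ 𝒞)) Ss + packingSum cs S
      ≡⟨ combine ⟩
    packingSum (c ∷ cs) S ∎
    where
    Ss : List (Subset (length cs))
    Ss = subsets (length cs)
    zeros : ∀ (xs : List (Subset (length cs))) → total (λ _ → 0ℤ) xs ≡ 0ℤ
    zeros []       = refl
    zeros (_ ∷ xs) = trans (ℤ.+-identityˡ _) (zeros xs)
    negate : ∀ (b : Bool) t → (if b then -1ℤ * t else 0ℤ) ≡ - (if b then t else 0ℤ)
    negate true  t = ℤ.-1*i≡-i t
    negate false t = refl
    combine :
      total (λ 𝒞 → weight (c ∷ cs) S (inside ∷ 𝒞)) Ss + packingSum cs S ≡ packingSum (c ∷ cs) S
    combine with does (V c ⊆? S)
    ... | false = trans (cong (λ t → t + packingSum cs S) (zeros Ss)) (ℤ.+-identityˡ _)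
    ... | true  = trans
      (cong (λ t → t + packingSum cs S)
        (trans (total-cong Ss λ 𝒞 → negate (does (packing? cs (S ─ V c) 𝒞)) (-1ℤ ^ ∣ 𝒞 ∣))
          (trans (total-neg (weight cs (S ─ V c)) Ss) (cong -_ (packingSum-counts cs (S ─ V c))))))
      (ℤ.+-comm (- packingSum cs (S ─ V c)) (packingSum cs S))

  -- The object c contains the vertex v and lies in S.
  Through : Fin n → Subset n → Pred A _
  Through v S c = v ∈ V c × V c ⊆ S

  through? : ∀ v S → Decidable (Through v S)
  through? v S c = (v ∈? V c) ×-dec (V c ⊆? S)

  -- The sum of f over the objects in the list that contain v and lie in S.
  through : Fin n → Subset n → (A → ℤ) → List A → ℤ
  through v S f = total (λ c → if does (through? v S c) then f c else 0ℤ)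

  private
    pick : ∀ {v S c t} → Through v S c → (if does (through? v S c) then t else 0ℤ) ≡ t
    pick {v} {S} {c} t rewrite dec-true (through? v S c) t = refl

    skip : ∀ {v S c t} → ¬ Through v S c → (if does (through? v S c) then t else 0ℤ) ≡ 0ℤ
    skip {v} {S} {c} t rewrite dec-false (through? v S c) t = refl

    ⊆─-swap : ∀ {S C D : Subset n} → D ⊆ S → C ⊆ S ─ D → D ⊆ S ─ C
    ⊆─-swap {S} {C} {D} D⊆S C⊆S─D x∈D =
      x∈p∧x∉q⇒x∈p─q (D⊆S x∈D) λ x∈C → x∈p─q⇒x∉q S D (C⊆S─D x∈C) x∈D

    ⊆∖ : ∀ {S C : Subset n} {v} → v ∉ C → C ⊆ S → C ⊆ S ∖ v
    ⊆∖ v∉C C⊆S x∈C = x∈p∧x≢y⇒x∈p-y (C⊆S x∈C) λ { refl → v∉C x∈C }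

  -- A packing in S either avoids v, or contains exactly one object through v, and
  -- the rest of it is a packing in the complement of that object. The induction on
  -- the list distinguishes whether the first object contains v and whether it lies
  -- in S.
  packingSum-through : ∀ cs {S v} → v ∈ S →
    packingSum cs S ≡ packingSum cs (S ∖ v) - through v S (λ d → packingSum cs (S ─ V d)) cs
  packingSum-through []       v∈S = refl
  packingSum-through (c ∷ cs) {S} {v} v∈S with v ∈? V c
  ... | yes v∈c = begin
    packingSum (c ∷ cs) S
      ≡⟨ lhs ⟩
    packingSum cs S - here-term
      ≡⟨ cong (_- here-term) (packingSum-through cs v∈S) ⟩
    (packingSum cs (S ∖ v) - through v S (λ d → packingSum cs (S ─ V d)) cs) - here-term
      ≡⟨ regroup (packingSum cs (S ∖ v)) _ here-term ⟩
    packingSum cs (S ∖ v) - (here-term + through v S (λ d → packingSum cs (S ─ V d)) cs)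
      ≡⟨ cong₂ (λ s t → s - (here-term + t))
           (sym (packingSum-⊈ cs λ c⊆ → x∉p∖x S v (c⊆ v∈c)))
           (total-cong cs later) ⟩
    packingSum (c ∷ cs) (S ∖ v) - (here-term + through v S (λ d → packingSum (c ∷ cs) (S ─ V d)) cs) ∎
    where
    -- The term of c in the sum over the objects through v.
    here-term : ℤ
    here-term = if does (V c ⊆? S) then packingSum (c ∷ cs) (S ─ V c) else 0ℤ
    regroup : ∀ s t u → (s - t) - u ≡ s - (u + t)
    regroup = solve-∀
    misses : ∀ D → v ∈ D → packingSum (c ∷ cs) (S ─ D) ≡ packingSum cs (S ─ D)
    misses D v∈D = packingSum-⊈ cs λ c⊆ → x∈p─q⇒x∉q S D (c⊆ v∈c) v∈D
    lhs : packingSum (c ∷ cs) S ≡ packingSum cs S - here-term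
    lhs with does (V c ⊆? S)
    ... | true  = cong (λ t → packingSum cs S - t) (sym (misses (V c) v∈c))
    ... | false = sym (ℤ.+-identityʳ (packingSum cs S))
    later : ∀ d → (if does (through? v S d) then packingSum cs (S ─ V d) else 0ℤ)
                ≡ (if does (through? v S d) then packingSum (c ∷ cs) (S ─ V d) else 0ℤ)
    later d with through? v S d
    ... | yes t = trans (pick t) (trans (sym (misses (V d) (proj₁ t))) (sym (pick t)))
    ... | no ¬t = trans (skip ¬t) (sym (skip ¬t))
  ... | no v∉c with V c ⊆? S
  ...   | no c⊈S = begin
    packingSum cs S
      ≡⟨ packingSum-through cs v∈S ⟩
    packingSum cs (S ∖ v) - through v S (λ d → packingSum cs (S ─ V d)) cs
      ≡⟨ cong₂ _-_ (sym (misses ⁅ v ⁆)) (total-cong cs λ d →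
           cong (λ t → if does (through? v S d) then t else 0ℤ) (sym (misses (V d)))) ⟩
    packingSum (c ∷ cs) (S ∖ v) - through v S (λ d → packingSum (c ∷ cs) (S ─ V d)) cs
      ≡⟨ cong (λ t → packingSum (c ∷ cs) (S ∖ v) - t) (ℤ.+-identityˡ _) ⟨
    packingSum (c ∷ cs) (S ∖ v) - (0ℤ + through v S (λ d → packingSum (c ∷ cs) (S ─ V d)) cs) ∎
    where
    misses : ∀ D → packingSum (c ∷ cs) (S ─ D) ≡ packingSum cs (S ─ D)
    misses D = packingSum-⊈ cs λ c⊆ → c⊈S (p─q⊆p S D ∘ c⊆)
  ...   | yes c⊆S = begin
    packingSum cs S - packingSum cs (S ─ V c)
      ≡⟨ cong₂ _-_ (packingSum-through cs v∈S)
           (packingSum-through cs (x∈p∧x∉q⇒x∈p─q v∈S v∉c)) ⟩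
    (packingSum cs (S ∖ v) - T) - (packingSum cs (S ─ V c ∖ v) - T′)
      ≡⟨ regroup (packingSum cs (S ∖ v)) T (packingSum cs (S ─ V c ∖ v)) T′ ⟩
    (packingSum cs (S ∖ v) - packingSum cs (S ─ V c ∖ v)) - (0ℤ + (T - T′))
      ≡⟨ cong₂ (λ s t → s - (0ℤ + t))
           (trans (cong (λ U → packingSum cs (S ∖ v) - packingSum cs U)
               (p─q─r≡p─r─q S (V c) ⁅ v ⁆))
             (sym (packingSum-⊆ cs (⊆∖ v∉c c⊆S))))
           (trans (sym (total-minus _ _ cs)) (total-cong cs later)) ⟩
    packingSum (c ∷ cs) (S ∖ v) - (0ℤ + through v S (λ d → packingSum (c ∷ cs) (S ─ V d)) cs) ∎
    where
    T T′ : ℤ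
    T  = through v S (λ d → packingSum cs (S ─ V d)) cs
    T′ = through v (S ─ V c) (λ d → packingSum cs (S ─ V c ─ V d)) cs
    regroup : ∀ s t u w → (s - t) - (u - w) ≡ (s - u) - (0ℤ + (t - w))
    regroup = solve-∀
    -- Both sides vanish unless d contains v and lies in S. If c lies in S ─ V d,
    -- then d lies in S ─ V c; otherwise c and d meet and T′ has no term of d.
    later : ∀ d →
      (if does (through? v S d) then packingSum cs (S ─ V d) else 0ℤ)
        - (if does (through? v (S ─ V c) d) then packingSum cs (S ─ V c ─ V d) else 0ℤ)
      ≡ (if does (through? v S d) then packingSum (c ∷ cs) (S ─ V d) else 0ℤ)
    later d = cases (through? v S d) (V c ⊆? S ─ V d)
      where
      cases : Dec (Through v S d) → Dec (V c ⊆ S ─ V d) → _ ≡ _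
      cases (no ¬t) _ = trans
        (cong₂ _-_ (skip ¬t) (skip {v} λ (v∈d , d⊆) → ¬t (v∈d , p─q⊆p S (V c) ∘ d⊆)))
        (sym (skip ¬t))
      cases (yes t@(v∈d , d⊆S)) (yes c⊆) = trans
        (cong₂ _-_ (pick t) (trans (pick (v∈d , ⊆─-swap d⊆S c⊆))
          (cong (packingSum cs) (p─q─r≡p─r─q S (V c) (V d)))))
        (trans (sym (packingSum-⊆ cs c⊆)) (sym (pick t)))
      cases (yes t) (no c⊈) = trans
        (cong₂ _-_ (pick t) (skip {v} λ (_ , d⊆) → c⊈ (⊆─-swap c⊆S d⊆)))
        (trans (ℤ.+-identityʳ _) (trans (sym (packingSum-⊈ cs c⊈)) (sym (pick t))))

-- Sets and lists without repetitions

∈-toSet⁺ : {x : Fin n} {xs : List (Fin n)} → x ∈ˡ xs → x ∈ toSet xs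
∈-toSet⁺ (here refl) = x∈p∪q⁺ (inj₁ (x∈⁅x⁆ _))
∈-toSet⁺ (there x∈)  = x∈p∪q⁺ (inj₂ (∈-toSet⁺ x∈))

∈-toSet⁻ : {x : Fin n} (xs : List (Fin n)) → x ∈ toSet xs → x ∈ˡ xs
∈-toSet⁻ []       x∈ = ⊥-elim (∉⊥ x∈)
∈-toSet⁻ (y ∷ xs) x∈ with x∈p∪q⁻ ⁅ y ⁆ (toSet xs) x∈
... | inj₁ x∈y  = here (x∈⁅y⁆⇒x≡y y x∈y)
... | inj₂ x∈xs = there (∈-toSet⁻ xs x∈xs)

unique-map-∈ : (f : A → B) {xs : List A} →
  (∀ {x y} → x ∈ˡ xs → y ∈ˡ xs → f x ≡ f y → x ≡ y) → Unique xs → Unique (map f xs)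
unique-map-∈ f inj []         = []
unique-map-∈ f inj (x≢ ∷ uniq) =
  All.map⁺ (All.tabulate λ y∈ fx≡fy → All.lookup x≢ y∈ (inj (here refl) (there y∈) fx≡fy))
  ∷ unique-map-∈ f (λ x∈ y∈ → inj (there x∈) (there y∈)) uniq

unique-lookup : (f : A → B) (xs : List A) → Unique (map f xs) →
  ∀ {i j} → f (lookup xs i) ≡ f (lookup xs j) → i ≡ j
unique-lookup f (x ∷ xs) uniq {zero}  {zero}  eq = refl
unique-lookup f (x ∷ xs) (x≢ ∷ _) {zero}  {suc j} eq =
  contradiction eq (All.lookup x≢ (∈-map⁺ f (∈-lookup j)))
unique-lookup f (x ∷ xs) (x≢ ∷ _) {suc i} {zero}  eq =
  contradiction (sym eq) (All.lookup x≢ (∈-map⁺ f (∈-lookup i)))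
unique-lookup f (x ∷ xs) (_ ∷ uniq) {suc i} {suc j} eq = cong suc (unique-lookup f xs uniq eq)

unique-map-head : (f : A → B) {x : A} {xs : List A} → Unique (map f (x ∷ xs)) →
  ∀ {y} → y ∈ˡ xs → f y ≢ f x
unique-map-head f (x≢ ∷ _) y∈ fy≡fx = All.lookup x≢ (∈-map⁺ f y∈) (sym fy≡fx)

∈-subsets : (S : Subset n) → S ∈ˡ subsets n
∈-subsets []            = here refl
∈-subsets (inside  ∷ S) = ∈-++⁺ˡ (∈-map⁺ (inside ∷_) (∈-subsets S))
∈-subsets {suc n} (outside ∷ S) =
  ∈-++⁺ʳ (map (inside ∷_) (subsets n)) (∈-map⁺ (outside ∷_) (∈-subsets S))

subsets-unique : ∀ n → Unique (subsets n)
subsets-unique zero    = [] ∷ []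
subsets-unique (suc n) = Unique.++⁺
  (Unique.map⁺ (proj₂ ∘ ∷-injective) (subsets-unique n))
  (Unique.map⁺ (proj₂ ∘ ∷-injective) (subsets-unique n))
  λ (in∈ , out∈) → clash (∈-map⁻ (inside ∷_) in∈) (∈-map⁻ (outside ∷_) out∈)
  where
  clash : ∀ {S} → (∃ λ T → T ∈ˡ subsets n × S ≡ inside ∷ T) →
    (∃ λ T → T ∈ˡ subsets n × S ≡ outside ∷ T) → _
  clash (_ , _ , refl) (_ , _ , ())

-- Simple paths and closed walks

module Cycles (src tgt : Fin m → Fin n) where
  open Digraph src tgt

  -- The vertices that are sources of edges in C.
  sourceSet : Subset m → Subset n
  sourceSet C = toSet (map src (filter (_∈? C) (allFin m)))

  ∈-sourceSet⁺ : ∀ {C x} → x ∈ C → src x ∈ sourceSet C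
  ∈-sourceSet⁺ {C} {x} x∈C = ∈-toSet⁺ (∈-map⁺ src (∈-filter⁺ (_∈? C) (∈-allFin x) x∈C))

  ∈-sourceSet⁻ : ∀ {C v} → v ∈ sourceSet C → ∃ λ x → x ∈ C × src x ≡ v
  ∈-sourceSet⁻ {C} v∈ with ∈-map⁻ src (∈-toSet⁻ (map src (filter (_∈? C) (allFin m))) v∈)
  ... | x , x∈ , refl = x , proj₂ (∈-filter⁻ (_∈? C) {xs = allFin m} x∈) , refl

  sourceSet-toSet : ∀ es → sourceSet (toSet es) ≡ visited es
  sourceSet-toSet es = ⊆-antisym to from
    where
    to : sourceSet (toSet es) ⊆ visited es
    to v∈ with ∈-sourceSet⁻ v∈
    ... | x , x∈ , refl = ∈-toSet⁺ (∈-map⁺ src (∈-toSet⁻ es x∈))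
    from : visited es ⊆ sourceSet (toSet es)
    from v∈ with ∈-map⁻ src (∈-toSet⁻ (map src es) v∈)
    ... | x , x∈ , refl = ∈-sourceSet⁺ (∈-toSet⁺ x∈)

  -- Path v S w es means that es is a path from w to v of the kind listed by paths:
  -- it stops at the first arrival in v, and its sources are pairwise distinct and,
  -- apart from w, in S.
  data Path (v : Fin n) (S : Subset n) : Fin n → List (Fin m) → Set where
    last : ∀ {e} → tgt e ≡ v → Path v S (src e) (e ∷ [])
    step : ∀ {e es} → tgt e ≢ v → tgt e ∈ S ∖ src e → Path v (S ∖ src e) (tgt e) es →
      Path v S (src e) (e ∷ es)

  ∈-paths⁻ : ∀ k {S v w es} → es ∈ˡ paths k S v w → Path v S w es
  ∈-paths⁻ (suc k) {S} {v} {w} {es} es∈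
    with find (∈-concatMap⁻ (pathsVia k S v w) {xs = out w} es∈)
  ... | e , e∈ , es∈via = via e (∈-out⁻ e∈) es∈via
    where
    via : ∀ e → src e ≡ w → es ∈ˡ pathsVia k S v w e → Path v S w es
    via e refl es∈ with tgt e ≟ v
    via e refl (here refl) | yes tgt≡v = last tgt≡v
    via e refl es∈ | no tgt≢v with tgt e ∈? S ∖ w
    via e refl es∈ | no tgt≢v | yes tgt∈ with ∈-map⁻ (e ∷_) es∈
    ... | _ , p∈ , refl = step tgt≢v tgt∈ (∈-paths⁻ k p∈)
    via e refl () | no tgt≢v | no _

  ∈-paths⁺ : ∀ k {S v w es} → ∣ S ∣ ℕ.≤ k → w ∈ S → Path v S w es → es ∈ˡ paths k S v w
  ∈-paths⁺ zero ∣S∣≤0 w∈S _ = contradiction (ℕ.<-≤-trans (x∈p⇒∣p-x∣<∣p∣ w∈S) ∣S∣≤0) λ ()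
  ∈-paths⁺ (suc k) {S} {v} {es = es} ∣S∣≤1+k w∈S path =
    ∈-concatMap⁺ (pathsVia k S v _) (via w∈S path)
    where
    via : ∀ {w es} → w ∈ S → Path v S w es → Any (λ e → es ∈ˡ pathsVia k S v w e) (out w)
    via w∈S (last {e} tgt≡v) = lose (∈-out⁺ refl) it
      where
      it : (e ∷ []) ∈ˡ pathsVia k S v (src e) e
      it rewrite dec-true (tgt e ≟ v) tgt≡v = here refl
    via w∈S (step {e} {es} tgt≢v tgt∈ rest) = lose (∈-out⁺ refl) it
      where
      it : (e ∷ es) ∈ˡ pathsVia k S v (src e) e
      it rewrite dec-false (tgt e ≟ v) tgt≢v | dec-true (tgt e ∈? S ∖ src e) tgt∈ =
        ∈-map⁺ (e ∷_) (∈-paths⁺ k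
          (s≤s⁻¹ (ℕ.≤-trans (x∈p⇒∣p-x∣<∣p∣ w∈S) ∣S∣≤1+k)) tgt∈ rest)

  path-sources : ∀ {v S w es} → w ∈ S → Path v S w es → ∀ {x} → x ∈ˡ es → src x ∈ S
  path-sources w∈S (last _)           (here refl) = w∈S
  path-sources w∈S (step _ _ _)       (here refl) = w∈S
  path-sources {S = S} w∈S (step _ tgt∈ rest) (there x∈) =
    p─q⊆p S _ (path-sources tgt∈ rest x∈)

  path-head-fresh : ∀ {v S e es} → tgt e ∈ S ∖ src e → Path v (S ∖ src e) (tgt e) es →
    ∀ {x} → x ∈ˡ es → src x ≢ src e
  path-head-fresh {S = S} {e} tgt∈ rest x∈ eq =
    x∉p∖x S (src e) (subst (_∈ S ∖ src e) eq (path-sources tgt∈ rest x∈))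

  path-unique : ∀ {v S w es} → w ∈ S → Path v S w es → Unique (map src es)
  path-unique w∈S (last _) = [] ∷ []
  path-unique w∈S (step _ tgt∈ rest) =
    All.map⁺ (All.tabulate λ x∈ eq → path-head-fresh tgt∈ rest x∈ (sym eq))
    ∷ path-unique tgt∈ rest

  -- A path is determined by its set of edges, because at each vertex it passes
  -- exactly one of these edges leaves that vertex.
  path-determined : ∀ {v S w es fs} → Path v S w es → Path v S w fs →
    (∀ {x} → x ∈ˡ es → x ∈ˡ fs) → (∀ {x} → x ∈ˡ fs → x ∈ˡ es) → es ≡ fs
  path-determined p q to from = go p q refl to from
    where
    tail⊆ : ∀ {v S e es fs} → tgt e ∈ S ∖ src e → Path v (S ∖ src e) (tgt e) es →
      (∀ {x} → x ∈ˡ e ∷ es → x ∈ˡ e ∷ fs) → ∀ {x} → x ∈ˡ es → x ∈ˡ fs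
    tail⊆ tgt∈ rest to x∈ with to (there x∈)
    ... | here refl = contradiction refl (path-head-fresh tgt∈ rest x∈)
    ... | there x∈fs = x∈fs
    go : ∀ {v S w w′ es fs} → Path v S w es → Path v S w′ fs → w ≡ w′ →
      (∀ {x} → x ∈ˡ es → x ∈ˡ fs) → (∀ {x} → x ∈ˡ fs → x ∈ˡ es) → es ≡ fs
    go (last _) (last _) _ to _ with to (here refl)
    ... | here refl = refl
    go (last tgt≡v) (step tgt≢v _ _) _ _ from with from (here refl)
    ... | here refl = contradiction tgt≡v tgt≢v
    go (step tgt≢v _ _) (last tgt≡v) _ to _ with to (here refl)
    ... | here refl = contradiction tgt≡v tgt≢v
    go (step _ tgt∈ p) (step _ tgt∈′ q) w≡w′ to from with to (here refl)
    ... | there e∈ = contradiction w≡w′ (path-head-fresh tgt∈′ q e∈)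
    ... | here refl = cong (_ ∷_) (go p q refl (tail⊆ tgt∈ p to) (tail⊆ tgt∈′ q from))

  paths-unique : ∀ k S v w → Unique (paths k S v w)
  paths-unique zero    S v w = []
  paths-unique (suc k) S v w = Unique.concat⁺
    (All.map⁺ (All.tabulate λ {e} _ → via-unique e))
    (AllPairs.map⁺ (AllPairs.map via-disjoint
      (Unique.filter⁺ (λ e → src e ≟ w) (Unique.allFin⁺ m))))
    where
    via-head : ∀ e {es} → es ∈ˡ pathsVia k S v w e → ∃ λ fs → es ≡ e ∷ fs
    via-head e es∈ with does (tgt e ≟ v)
    via-head e (here refl) | true = _ , refl
    via-head e es∈ | false with does (tgt e ∈? S ∖ w)
    via-head e es∈ | false | true with ∈-map⁻ (e ∷_) es∈
    ... | fs , _ , eq = fs , eq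
    via-head e () | false | false
    via-disjoint : ∀ {e f} → e ≢ f → Disjointˡ (pathsVia k S v w e) (pathsVia k S v w f)
    via-disjoint e≢f (es∈e , es∈f) with via-head _ es∈e | via-head _ es∈f
    ... | _ , refl | _ , refl = e≢f refl
    via-unique : ∀ e → Unique (pathsVia k S v w e)
    via-unique e with does (tgt e ≟ v)
    ... | true = [] ∷ []
    ... | false with does (tgt e ∈? S ∖ w)
    ...   | true  = Unique.map⁺ ∷-injectiveʳ (paths-unique k (S ∖ w) v (tgt e))
    ...   | false = []

  pathSets-unique : ∀ k S v w → Unique (map toSet (paths k S v w))
  pathSets-unique k S v w = unique-map-∈ toSet
    (λ {es} {fs} es∈ fs∈ eq → path-determined (∈-paths⁻ k es∈) (∈-paths⁻ k fs∈)
      (λ x∈ → ∈-toSet⁻ fs (subst (_ ∈_) eq (∈-toSet⁺ x∈)))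
      (λ x∈ → ∈-toSet⁻ es (subst (_ ∈_) (sym eq) (∈-toSet⁺ x∈))))
    (paths-unique k S v w)

  -- Walk v w es means that the edges es lead from w to v, with repetitions allowed.
  -- The equation in the constructor keeps the source function out of the index.
  data Walk (v : Fin n) : Fin n → List (Fin m) → Set where
    []  : Walk v v []
    _∷_ : ∀ {u e es} → src e ≡ u → Walk v (tgt e) es → Walk v u (e ∷ es)

  path⇒walk : ∀ {v S w es} → Path v S w es → Walk v w es
  path⇒walk (last refl)     = refl ∷ []
  path⇒walk (step _ _ rest) = refl ∷ path⇒walk rest

  walk⇒path : ∀ {v S w e es} → Walk v w (e ∷ es) → Unique (map src (e ∷ es)) →
    (∀ {x} → x ∈ˡ e ∷ es → src x ∈ S) → v ∉ˡ map src es → Path v S w (e ∷ es)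
  walk⇒path (refl ∷ [])     uniq inS v∉ = last refl
  walk⇒path (refl ∷ eq ∷ p) uniq@(_ ∷ uniq′) inS v∉ =
    step (λ tgt≡v → v∉ (here (sym (trans eq tgt≡v))))
      (subst (_∈ _) eq (x∈p∧x≢y⇒x∈p-y (inS (there (here refl))) (fresh (here refl))))
      (walk⇒path (eq ∷ p) uniq′ (λ x∈ → x∈p∧x≢y⇒x∈p-y (inS (there x∈)) (fresh x∈)) (v∉ ∘ there))
    where
    fresh : ∀ {x} → _ → src x ≢ _
    fresh = unique-map-head src uniq

  walk-++ : ∀ {u v w xs ys} → Walk u w xs → Walk v u ys → Walk v w (xs ++ ys)
  walk-++ []       q = q
  walk-++ (eq ∷ p) q = eq ∷ walk-++ p q

  walk-split : ∀ {v w} xs {x ys} → Walk v w (xs ++ x ∷ ys) →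
    Walk (src x) w xs × Walk v (src x) (x ∷ ys)
  walk-split []       (refl ∷ p) = [] , refl ∷ p
  walk-split (e ∷ xs) (eq ∷ p) with walk-split xs p
  ... | q , r = eq ∷ q , r

  -- A closed walk can be started at any of its edges.
  walk-rotate : ∀ {v es x} → Walk v v es → x ∈ˡ es →
    ∃ λ fs → Walk (src x) (src x) (x ∷ fs) × es ↭ x ∷ fs
  walk-rotate {x = x} p x∈ with ∈-∃++ x∈
  ... | xs , ys , refl with walk-split xs p
  ... | q , r = ys ++ xs , walk-++ r q , ++-comm xs (x ∷ ys)

  closedWalk⇒path : ∀ {v S es x} → Walk v v es → Unique (map src es) → x ∈ˡ es →
    (∀ {y} → y ∈ˡ es → src y ∈ S) → ∃ λ fs → Path (src x) S (src x) fs × es ↭ fs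
  closedWalk⇒path {x = x} p uniq x∈ inS with walk-rotate p x∈
  ... | fs , q , es↭ = x ∷ fs ,
    walk⇒path q uniq′ (inS ∘ ∈-resp-↭ (↭-sym es↭)) (Unique.Unique[x∷xs]⇒x∉xs uniq′) ,
    es↭
    where
    uniq′ : Unique (map src (x ∷ fs))
    uniq′ = ↭ₛ.Unique-resp-↭ (setoid (Fin n)) (↭⇒↭ₛ (↭-map⁺ src es↭)) uniq

  walk-tabulate : ∀ {k} (f : Fin (suc k) → Fin m) →
    (∀ i → tgt (f (inject₁ i)) ≡ src (f (suc i))) →
    Walk (tgt (f (fromℕ k))) (src (f zero)) (tabulate f)
  walk-tabulate {zero}  f link = refl ∷ []
  walk-tabulate {suc k} f link = refl ∷
    subst (λ u → Walk _ u _) (sym (link zero)) (walk-tabulate (f ∘ suc) (link ∘ suc))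

  walk-link : ∀ {v w e es} → Walk v w (e ∷ es) →
    ∀ i → tgt (lookup (e ∷ es) (inject₁ i)) ≡ src (lookup es i)
  walk-link (_ ∷ eq ∷ p) zero    = sym eq
  walk-link (_ ∷ eq ∷ p) (suc i) = walk-link (eq ∷ p) i

  walk-end : ∀ {v w e es} → Walk v w (e ∷ es) → tgt (lookup (e ∷ es) (fromℕ (length es))) ≡ v
  walk-end (_ ∷ [])     = refl
  walk-end (_ ∷ eq ∷ p) = walk-end (eq ∷ p)

-- Circuits of a finite graph

total-indicator : {P : Pred A p} {R : Pred A r} (P? : Decidable P) (R? : Decidable R)
  (xs : List A) →
  + length (filter (λ x → P? x ×-dec R? x) xs) ≡
  total (λ x → if does (R? x) then 1ℤ else 0ℤ) (filter P? xs)
total-indicator P? R? [] = refl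
total-indicator P? R? (x ∷ xs) with does (P? x)
... | false = total-indicator P? R? xs
... | true  with does (R? x)
...   | false = trans (total-indicator P? R? xs) (sym (ℤ.+-identityˡ _))
...   | true  = cong (λ t → 1ℤ + t) (total-indicator P? R? xs)

module _ {a b} (E : Graph a b) (fin : Finite E) where
  open Graph E
  open Finite fin

  private
    src tgt : Fin #edges → Fin #vertices
    src = vertexIndex ∘ source ∘ edge
    tgt = vertexIndex ∘ range ∘ edge

    vertexIndex-injective : ∀ {u v} → vertexIndex u ≡ vertexIndex v → u ≡ v
    vertexIndex-injective = Injection.injective (↔⇒↣ vertices)

    edge∘edgeIndex : ∀ x → edge (edgeIndex x) ≡ x
    edge∘edgeIndex = Inverse.strictlyInverseʳ edges

    edgeIndex∘edge : ∀ x → edgeIndex (edge x) ≡ x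
    edgeIndex∘edge = Inverse.strictlyInverseˡ edges

    edge-injective : ∀ {x y} → edge x ≡ edge y → x ≡ y
    edge-injective {x} {y} eq =
      trans (sym (edgeIndex∘edge x)) (trans (cong edgeIndex eq) (edgeIndex∘edge y))

  open Digraph src tgt
  open Cycles src tgt
  open Packings sourceSet

  path⇒circuit : ∀ {v S es} → v ∈ S → Path v S v es → IsCircuit E fin (toSet es)
  path⇒circuit {es = []} v∈S ()
  path⇒circuit {v} {es = es@(e ∷ es′)} v∈S path = length es′ , vec , record
    { consecutive = λ i → vertexIndex-injective
        (trans (cong (vertexIndex ∘ range) (vec-lookup (inject₁ i)))
          (trans (walk-link walk i) (sym (cong (vertexIndex ∘ source) (vec-lookup (suc i))))))
    ; closed = vertexIndex-injective
        (trans (cong (vertexIndex ∘ range) (vec-lookup (fromℕ (length es′))))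
          (trans (walk-end walk) (trans (sym (head-source walk))
            (sym (cong (vertexIndex ∘ source) (vec-lookup zero))))))
    ; distinct = λ i j i≢j eq → i≢j (unique-lookup src es uniq
        (trans (sym (cong (vertexIndex ∘ source) (vec-lookup i)))
          (trans (cong vertexIndex eq) (cong (vertexIndex ∘ source) (vec-lookup j)))))
    } , record
    { used = λ i → subst (_∈ toSet es)
        (sym (trans (cong edgeIndex (vec-lookup i)) (edgeIndex∘edge (lookup es i))))
        (∈-toSet⁺ (∈-lookup {xs = es} i))
    ; usedOnce = λ x x∈ → let x∈es = ∈-toSet⁻ es x∈ in
        index x∈es ,
        trans (vec-lookup (index x∈es)) (cong edge (sym (lookup-index x∈es))) ,
        λ {j} eq → unique-lookup src es uniq
          (cong src (trans (sym (lookup-index x∈es))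
            (edge-injective (trans (sym eq) (vec-lookup j)))))
    }
    where
    vec : Vec Edge (suc (length es′))
    vec = Vec.tabulate (edge ∘ lookup es)
    vec-lookup : ∀ i → Vec.lookup vec i ≡ edge (lookup es i)
    vec-lookup = lookup∘tabulate (edge ∘ lookup es)
    walk : Walk v v es
    walk = path⇒walk path
    uniq : Unique (map src es)
    uniq = path-unique v∈S path
    head-source : ∀ {w} → Walk v w es → src e ≡ w
    head-source (eq ∷ _) = eq

  -- The cycle is read in terms of edge indices, as a list.
  circuit⇒closedWalk : ∀ {C} → IsCircuit E fin C → ∃ λ v → ∃ λ es → Walk v v es ×
    Unique (map src es) × (∀ {x} → x ∈ C → x ∈ˡ es) × (∀ {x} → x ∈ˡ es → x ∈ C)
  circuit⇒closedWalk {C} (k , e , cycle , arranges) =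
    src (f zero) , tabulate f ,
    subst (λ v → Walk v (src (f zero)) (tabulate f))
      (trans (tgt-f (fromℕ k)) (trans (cong vertexIndex closed) (sym (src-f zero))))
      (walk-tabulate f λ i → trans (tgt-f (inject₁ i))
        (trans (cong vertexIndex (consecutive i)) (sym (src-f (suc i))))) ,
    subst Unique (sym (map-tabulate f src)) (Unique.tabulate⁺ λ {i} {j} eq →
      decidable-stable (i ≟ j) λ i≢j → distinct i j i≢j
        (vertexIndex-injective (trans (sym (src-f i)) (trans eq (src-f j))))) ,
    (λ {x} x∈ → let i , eq , _ = usedOnce x x∈ in
      subst (_∈ˡ tabulate f) (trans (cong edgeIndex eq) (edgeIndex∘edge x))
        (∈-tabulate⁺ {f = f} i)) ,
    (λ x∈ → let i , eq = ∈-tabulate⁻ {f = f} x∈ in subst (_∈ C) (sym eq) (used i))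
    where
    open IsCycle cycle
    open Arranges arranges
    f : Fin (suc k) → Fin #edges
    f i = edgeIndex (Vec.lookup e i)
    src-f : ∀ i → src (f i) ≡ vertexIndex (source (Vec.lookup e i))
    src-f i = cong (vertexIndex ∘ source) (edge∘edgeIndex (Vec.lookup e i))
    tgt-f : ∀ i → tgt (f i) ≡ vertexIndex (range (Vec.lookup e i))
    tgt-f i = cong (vertexIndex ∘ range) (edge∘edgeIndex (Vec.lookup e i))

  circuit⇒path : ∀ {C v S} → IsCircuit E fin C → v ∈ sourceSet C → sourceSet C ⊆ S →
    ∃ λ es → Path v S v es × C ≡ toSet es
  circuit⇒path circuit v∈ C⊆S with circuit⇒closedWalk circuit | ∈-sourceSet⁻ v∈
  ... | _ , es , walk , uniq , to , from | x , x∈ , refl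
    with closedWalk⇒path walk uniq (to x∈) (C⊆S ∘ ∈-sourceSet⁺ ∘ from)
  ... | fs , path , es↭fs = fs , path , ⊆-antisym
    (∈-toSet⁺ ∘ ∈-resp-↭ es↭fs ∘ to)
    (from ∘ ∈-resp-↭ (↭-sym es↭fs) ∘ ∈-toSet⁻ fs)

  -- cs is any list of all circuits without repetitions.
  module _ (cs : List (Subset #edges)) (cs-unique : Unique cs)
    (∈-cs⁺ : ∀ {C} → IsCircuit E fin C → C ∈ˡ cs)
    (∈-cs⁻ : ∀ {C} → C ∈ˡ cs → IsCircuit E fin C) where

    -- The cycles through v in S, listed by their paths starting at v, are the circuits
    -- through v in S: both lists are free of repetitions and have the same members.
    circuits-through : ∀ {v S} → v ∈ S →
      map toSet (paths ∣ S ∣ S v v) ↭ filter (through? v S) cs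
    circuits-through {v} {S} v∈S = ∼bag⇒↭ (unique∧set⇒bag
      (pathSets-unique ∣ S ∣ S v v)
      (Unique.filter⁺ (through? v S) cs-unique)
      (mk⇔ to from))
      where
      to : ∀ {C} → C ∈ˡ map toSet (paths ∣ S ∣ S v v) → C ∈ˡ filter (through? v S) cs
      to C∈ with ∈-map⁻ toSet C∈
      ... | es , es∈ , refl = ∈-filter⁺ (through? v S) (∈-cs⁺ (path⇒circuit v∈S path))
        (path-start path , ⊆S)
        where
        path : Path v S v es
        path = ∈-paths⁻ ∣ S ∣ es∈
        path-start : ∀ {w es} → Path v S w es → w ∈ sourceSet (toSet es)
        path-start {es = es} (last _)     =
          ∈-sourceSet⁺ {C = toSet es} (∈-toSet⁺ {xs = es} (here refl))
        path-start {es = es} (step _ _ _) =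
          ∈-sourceSet⁺ {C = toSet es} (∈-toSet⁺ {xs = es} (here refl))
        ⊆S : sourceSet (toSet es) ⊆ S
        ⊆S u∈ with ∈-sourceSet⁻ {toSet es} u∈
        ... | x , x∈ , refl = path-sources v∈S path (∈-toSet⁻ es x∈)
      from : ∀ {C} → C ∈ˡ filter (through? v S) cs → C ∈ˡ map toSet (paths ∣ S ∣ S v v)
      from C∈ with ∈-filter⁻ (through? v S) {xs = cs} C∈
      ... | C∈cs , v∈C , C⊆S with circuit⇒path (∈-cs⁻ C∈cs) v∈C C⊆S
      ... | es , path , refl = ∈-map⁺ toSet (∈-paths⁺ ∣ S ∣ ℕ.≤-refl v∈S path)

    circuit-nonempty : ∀ {C} → C ∈ˡ cs → Nonempty (sourceSet C)
    circuit-nonempty {C} C∈ with ∈-cs⁻ C∈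
    ... | _ , e , _ , arranges = _ , ∈-sourceSet⁺ {C} (Arranges.used arranges zero)

    -- Both sides satisfy the same recursion, which removes from S a vertex v or a
    -- circuit through v. Here k bounds the induction on the size of S.
    detOn≡packingSum : ∀ k S → ∣ S ∣ ℕ.< k → detOn S ≡ packingSum cs S
    detOn≡packingSum (suc k) S ∣S∣<1+k with nonempty? S
    ... | no S-empty = trans
      (trans (det-cong λ i j → cong-app (restrict-∉ λ i∈S → S-empty (i , i∈S)) j)
        (det-identity {#vertices}))
      (sym (packingSum-empty S-empty cs circuit-nonempty))
    ... | yes (v , v∈S) = begin
      detOn S
        ≡⟨ detOn-recursion v∈S ⟩
      detOn (S ∖ v) - total (λ es → detOn (S ─ visited es)) (paths ∣ S ∣ S v v)
        ≡⟨ cong₂ _-_ (IH ⁅ v ⁆ (x∈⁅x⁆ v)) (begin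
          total (λ es → detOn (S ─ visited es)) (paths ∣ S ∣ S v v)
            ≡⟨ total-cong (paths ∣ S ∣ S v v) (λ es →
                 cong (λ T → detOn (S ─ T)) (sourceSet-toSet es)) ⟨
          total (λ es → detOn (S ─ sourceSet (toSet es))) (paths ∣ S ∣ S v v)
            ≡⟨ total-map (λ C → detOn (S ─ sourceSet C)) toSet (paths ∣ S ∣ S v v) ⟨
          total (λ C → detOn (S ─ sourceSet C)) (map toSet (paths ∣ S ∣ S v v))
            ≡⟨ total-↭ (λ C → detOn (S ─ sourceSet C)) (circuits-through v∈S) ⟩
          total (λ C → detOn (S ─ sourceSet C)) (filter (through? v S) cs)
            ≡⟨ total-cong-∈ (filter (through? v S) cs) (λ {C} C∈ → IH (sourceSet C)
                 (proj₁ (proj₂ (∈-filter⁻ (through? v S) {xs = cs} C∈)))) ⟩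
          total (λ C → packingSum cs (S ─ sourceSet C)) (filter (through? v S) cs)
            ≡⟨ total-filter (through? v S) (λ C → packingSum cs (S ─ sourceSet C)) cs ⟩
          through v S (λ C → packingSum cs (S ─ sourceSet C)) cs ∎) ⟩
      packingSum cs (S ∖ v) - through v S (λ C → packingSum cs (S ─ sourceSet C)) cs
        ≡⟨ packingSum-through cs v∈S ⟨
      packingSum cs S ∎
      where
      IH : ∀ T → v ∈ T → detOn (S ─ T) ≡ packingSum cs (S ─ T)
      IH T v∈T = detOn≡packingSum k (S ─ T) (ℕ.<-≤-trans
        (p∩q≢∅⇒∣p─q∣<∣p∣ S T (v , x∈p∩q⁺ (v∈S , v∈T))) (s≤s⁻¹ ∣S∣<1+k))

  parrySullivan≡detOn : parrySullivan E fin ≡ detOn ⊤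
  parrySullivan≡detOn = det-cong λ i j → sym (trans (cong-app (restrict-∈ {⊤} {i} ∈⊤) j)
    (cong (λ t → identity i j - t)
      (sym (total-indicator (λ x → src x ≟ i) (λ x → tgt x ≟ j) (allFin #edges)))))

  private
    cs : List (Subset #edges)
    cs = circuits E fin

  vertexDisjoint-packing : ∀ 𝒞 → does (vertexDisjoint? E fin 𝒞) ≡ does (packing? cs ⊤ 𝒞)
  vertexDisjoint-packing 𝒞 = does-⇔ (mk⇔ to from) (vertexDisjoint? E fin 𝒞) (packing? cs ⊤ 𝒞)
    where
    to : VertexDisjoint E fin 𝒞 → Packing cs ⊤ 𝒞
    to disj = disjoint⇒packing cs (λ _ _ _ → ∈⊤) λ i j i∈ j∈ i≢j x∈i x∈j →
      let e , e∈i , src-e = ∈-sourceSet⁻ x∈i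
          f , f∈j , src-f = ∈-sourceSet⁻ x∈j
      in disj i j i∈ j∈ i≢j
           ((e , e∈i , refl) , f , f∈j , vertexIndex-injective (trans src-f (sym src-e)))
    from : Packing cs ⊤ 𝒞 → VertexDisjoint E fin 𝒞
    from pk i j i∈ j∈ i≢j ((e , e∈i , refl) , f , f∈j , eq) =
      packing⇒disjoint cs pk i j i∈ j∈ i≢j (∈-sourceSet⁺ e∈i)
        (subst (_∈ sourceSet (circuit E fin j)) (cong vertexIndex eq) (∈-sourceSet⁺ f∈j))

  parrySullivan≡packingSum : parrySullivan E fin ≡ packingSum cs ⊤
  parrySullivan≡packingSum = trans parrySullivan≡detOn
    (detOn≡packingSum cs (Unique.filter⁺ (isCircuit? E fin) (subsets-unique #edges))
      (∈-filter⁺ (isCircuit? E fin) (∈-subsets _))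
      (λ C∈ → proj₂ (∈-filter⁻ (isCircuit? E fin) {xs = subsets #edges} C∈))
      (suc ∣ ⊤ {#vertices} ∣) ⊤ ℕ.≤-refl)

  packingSum≡even-odd :
    packingSum cs ⊤ ≡ + #evenVertexDisjoint E fin - + #oddVertexDisjoint E fin
  packingSum≡even-odd = begin
    packingSum cs ⊤
      ≡⟨ packingSum-counts cs ⊤ ⟨
    total (weight cs ⊤) (subsets (length cs))
      ≡⟨ total-cong (subsets (length cs)) (λ 𝒞 →
           cong (λ b → if b then -1ℤ ^ ∣ 𝒞 ∣ else 0ℤ) (vertexDisjoint-packing 𝒞)) ⟨
    total (λ 𝒞 → if does (vertexDisjoint? E fin 𝒞) then -1ℤ ^ ∣ 𝒞 ∣ else 0ℤ) (subsets (length cs))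
      ≡⟨ signed-count (vertexDisjoint? E fin) (λ 𝒞 → 2 ∣? ∣ 𝒞 ∣) (λ 𝒞 → -1ℤ ^ ∣ 𝒞 ∣)
           -1^even (λ {𝒞} → -1^odd ∣ 𝒞 ∣) (subsets (length cs)) ⟨
    + #evenVertexDisjoint E fin - + #oddVertexDisjoint E fin ∎

theorem6 : ∀ {a b} (E : Graph a b) (fin : Finite E) →
    parrySullivan E fin ≡ + #evenVertexDisjoint E fin - + #oddVertexDisjoint E fin
theorem6 E fin = trans (parrySullivan≡packingSum E fin) (packingSum≡even-odd E fin)
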